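{- Let $p$ be an odd prime, $x\in\mathbb Z_p$ with $x\not\equiv 0,-1\pmod p$, and $x'=(x-\langle x\rangle_p)/p$. Then $$\sum_{n=0}^{p-1}G_n(x)\equiv p^2\frac{x'(x'+1)+1-(-1)^{\langle x\rangle_p}}{x(x+1)}\pmod{p^3}.$$ Consequently, for every prime $p>3$: $$\sum_{n=0}^{p-1}\frac{G_n^{(3)}}{27^n}\equiv\begin{cases}p^2\pmod{p^3}&\text{if }p\equiv1\pmod 3,\\-8p^2\pmod{p^3}&\text{if }p\equiv2\pmod3,\end{cases}\qquad \sum_{n=0}^{p-1}\frac{G_n^{(4)}}{64^n}\equiv\begin{cases}p^2\pmod{p^3}&\text{if }p\equiv1,3\pmod 8,\\-\frac{29}3p^2\pmod{p^3}&\text{if }p\equiv5,7\pmod8,\end{cases}$$ $$\sum_{n=0}^{p-1}\frac{G_n^{(6)}}{432^n}\equiv\begin{cases}p^2\pmod{p^3}&\text{if }p\equiv1\pmod 4,\\-\frac{67}5p^2\pmod{p^3}&\text{if }p\equiv3\pmod4.\end{cases}$$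
   Context: For a real number $x$ and an integer $k\ge0$, $\binom xk=x(x-1)\cdots(x-k+1)/k!$. Define $G_n(x)=\sum_{k=0}^n\binom nk(-1)^k\binom xk\binom{ -1-x}k$. For a prime $p$, $\mathbb Z_p$ is the set of rational numbers whose denominator is not divisible by $p$; congruences modulo powers of $p$ are understood in $\mathbb Z_p$. For $x\in\mathbb Z_p$, $\langle x\rangle_p\in\{0,1,\ldots,p-1\}$ is determined by $x\equiv\langle x\rangle_p\pmod p$. Further, $G_n^{(3)}=27^nG_n(-\tfrac13)=\sum_{k=0}^n\binom nk(-1)^k\binom{2k}k\binom{3k}k27^{n-k}$, $G_n^{(4)}=64^nG_n(-\tfrac14)=\sum_{k=0}^n\binom nk(-1)^k\binom{2k}k\binom{4k}{2k}64^{n-k}$, $G_n^{(6)}=432^nG_n(-\tfrac16)=\sum_{k=0}^n\binom nk(-1)^k\binom{3k}k\binom{6k}{3k}432^{n-k}$. -}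

module Defs where

open import Data.Nat as ℕ using (ℕ; zero; suc; _%_)
open import Data.Nat.Combinatorics using (_C_)
open import Data.Nat.Divisibility using (_∣_)
open import Data.Nat.Primality using (Prime)
open import Data.Integer as ℤ using (ℤ; +_; -[1+_])
open import Data.Rational as ℚ using (ℚ; 0ℚ; 1ℚ; _+_; _*_; _-_; -_; _÷_; _/_; ↧ₙ_)
open import Data.Rational.Properties using (_≟_)
open import Data.Product using (Σ; _×_)
open import Relation.Nullary using (¬_; yes; no)

ℚof : ℕ → ℚ
ℚof n = + n / 1

_^_ : ℚ → ℕ → ℚ
q ^ zero = 1ℚ
q ^ suc n = q * (q ^ n)

-- total division (returns 0 when dividing by 0; only used with nonzero divisors)
_÷'_ : ℚ → ℚ → ℚ
a ÷' b with b ≟ 0ℚ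
... | yes _ = 0ℚ
... | no b≢0 = _÷_ a b {{ℚ.≢-nonZero b≢0}}

Σ≤ : ℕ → (ℕ → ℚ) → ℚ
Σ≤ zero f = f 0
Σ≤ (suc n) f = Σ≤ n f + f (suc n)

Σ< : ℕ → (ℕ → ℚ) → ℚ
Σ< zero f = 0ℚ
Σ< (suc n) f = Σ< n f + f n

binom : ℚ → ℕ → ℚ
binom x zero = 1ℚ
binom x (suc k) = binom x k * (x - ℚof k) * (+ 1 / suc k)

G : ℕ → ℚ → ℚ
G n x = Σ≤ n (λ k → ℚof (n C k) * ((- 1ℚ) ^ k) * binom x k * binom (- 1ℚ - x) k)

InZp : ℕ → ℚ → Set
InZp p x = ¬ (p ∣ ↧ₙ x)

_≡_[mod_^_] : ℚ → ℚ → ℕ → ℕ → Set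
a ≡ b [mod p ^ k ] = Σ ℚ (λ q → InZp p q × (a - b ≡ᵣ (ℚof p ^ k) * q))
  where
  open import Relation.Binary.PropositionalEquality using () renaming (_≡_ to _≡ᵣ_)

{-# OPTIONS --safe #-}
module Submission where

-- Put u_k = (-1)^k C(x,k) C(-1-x,k). The recurrence (k+1)² u_{k+1} = (x(x+1) - k(k+1)) u_k makes
-- the sum telescope to the exact identity
--   x (x+1) Σ_{n<p} G_n(x) = p² Σ_{k<p} C(p-1,k) u_{k+1}(x),
-- so the right-hand sum is only needed modulo p. Write x = r + p t with 0 ≤ r < p. For k < p-1 we
-- have C(p-1,k) ≡ (-1)^k and u_{k+1}(x) ≡ u_{k+1}(r), and these terms add up to 1 - (-1)^r because
-- Σ_{k<p} C(r,k) C(-1-r,k) = (-1)^r. In the last term C(r+pt,p) ≡ t and, since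
-- -1-x = (p-1-r) + p(-1-t), C(-1-x,p) ≡ -1-t, so u_p(x) ≡ t (t+1).

open import Defs
open import Data.Nat as ℕ using (ℕ; zero; suc; _<_; _%_)
open import Data.Nat.Primality using (Prime)
open import Data.Integer using (+_; -[1+_])
open import Data.Rational using (ℚ; 0ℚ; 1ℚ; _+_; _*_; _-_; -_; _/_)
open import Data.Product using (_×_)
open import Data.Sum using (_⊎_)
open import Relation.Nullary using (¬_)
open import Relation.Binary.PropositionalEquality using (_≡_)

import Data.Integer as ℤ
import Data.Integer.Properties as ℤ
import Data.Nat.Coprimality as Coprimality
import Data.Nat.Divisibility as ℕ
import Data.Nat.Properties as ℕ
import Data.Rational as ℚ
import Data.Rational.Properties as ℚ
import Data.Rational.Unnormalised as ℚᵘ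
import Data.Rational.Unnormalised.Properties as ℚᵘ
open import Data.Nat.Combinatorics using (_C_; nCk≡nC[n∸k]; nCn≡1; nCk+nC[k+1]≡[n+1]C[k+1]; k>n⇒nCk≡0)
open import Data.Nat.Divisibility using (_∣_; divides; divides-refl)
open import Data.Nat.DivMod using (m%n<n; m≡m%n+[m/n]*n; m∣n⇒o%n%m≡o%m)
open import Data.Nat.Primality using (euclidsLemma; prime?; prime⇒irreducible; prime⇒nonTrivial)
open import Data.Product using (_,_; proj₁; proj₂; ∃-syntax)
open import Data.Sum using (inj₁; inj₂; [_,_]′)
open import Data.Empty using (⊥-elim)
open import Function using (id; _∘_)
open import Level using (0ℓ)
open import Relation.Nullary using (Dec; yes; no; _×-dec_; _⊎-dec_; ¬?)
open import Relation.Nullary.Decidable using (dec⇒maybe; from-yes; from-no; _→-dec_)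
open import Relation.Binary.PropositionalEquality using (_≢_; refl; sym; trans; cong; cong₂; subst; module ≡-Reasoning)
open import Tactic.RingSolver using (solve-∀)
open import Data.Nat.Tactic.RingSolver using () renaming (solve-∀ to ℕ-solve-∀)
open import Tactic.RingSolver.Core.AlmostCommutativeRing using (AlmostCommutativeRing; fromCommutativeRing)

open ≡-Reasoning

-- Summing over n first turns C(n,k) into C(p,k+1). After the recurrence is applied, u_{k+1}
-- collects (k+1)² C(p,k+1) + (k+1)(k+2) C(p,k+2). Since (k+2) C(p,k+2) = (p-k-1) C(p,k+1), this
-- equals p (k+1) C(p,k+1) = p² C(p-1,k), which is the origin of the factor p². The term k = p-1
-- stands apart because C(y,p) has p in its denominator: its class modulo p is not determined by y
-- modulo p, and so it sees t. For x = -1/c with c = 3, 4, 6 the only residues prime to c are 1 and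
-- -1, so t = -e/c with e = 1 or e = c-1. Thus t = x or t = -1-x, and t(t+1) = x(x+1) in both cases.
-- The quotient becomes 1 + (1 - (-1)^r)/(x(x+1)): it is 1 for even r and 1 + 2/(x(x+1)) for odd r,
-- which gives -8, -29/3 and -67/5. The parity of r is read off from p modulo 2c.

ringℚ : AlmostCommutativeRing 0ℓ 0ℓ
ringℚ = fromCommutativeRing ℚ.+-*-commutativeRing (λ q → dec⇒maybe (0ℚ ℚ.≟ q))

-- Integers inside the rationals

ℤof : ℤ.ℤ → ℚ
ℤof i = i / 1

-- `_/_` normalises by a gcd that is stuck on a variable numerator; the explicit fraction over 1
-- lets `_+_` and `_*_` on ℚ compute.
ℤof-mkℚ : ∀ i → ℤof i ≡ ℚ.mkℚ i 0 (Coprimality.sym (Coprimality.1-coprimeTo ℤ.∣ i ∣))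
ℤof-mkℚ i = ℚ.↥p/↧p≡p (ℚ.mkℚ i 0 (Coprimality.sym (Coprimality.1-coprimeTo ℤ.∣ i ∣)))

ℤof-homo-+ : ∀ i j → ℤof (i ℤ.+ j) ≡ ℤof i + ℤof j
ℤof-homo-+ i j = begin
  ℤof (i ℤ.+ j) ≡⟨ cong ℤof (cong₂ ℤ._+_ (sym (ℤ.*-identityʳ i)) (sym (ℤ.*-identityʳ j))) ⟩
  ℤof (i ℤ.* + 1 ℤ.+ j ℤ.* + 1) ≡⟨ cong₂ _+_ (ℤof-mkℚ i) (ℤof-mkℚ j) ⟨
  ℤof i + ℤof j ∎

ℤof-homo-* : ∀ i j → ℤof (i ℤ.* j) ≡ ℤof i * ℤof j
ℤof-homo-* i j = sym (cong₂ _*_ (ℤof-mkℚ i) (ℤof-mkℚ j))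

ℤof-homo-neg : ∀ i → ℤof (ℤ.- i) ≡ - (ℤof i)
ℤof-homo-neg (+ zero)  = refl
ℤof-homo-neg (+ suc n) = refl
ℤof-homo-neg -[1+ n ]  = double-neg (ℚof (suc n))
  where
  double-neg : ∀ q → q ≡ - - q
  double-neg = solve-∀ ringℚ

ℚof-suc : ∀ n → ℚof (suc n) ≡ ℚof n + 1ℚ
ℚof-suc n = begin
  ℚof (suc n) ≡⟨ cong ℚof (ℕ.+-comm n 1) ⟨
  ℚof (n ℕ.+ 1) ≡⟨ ℤof-homo-+ (+ n) (+ 1) ⟩
  ℚof n + 1ℚ ∎

ℚof-+ : ∀ m n → ℚof (m ℕ.+ n) ≡ ℚof m + ℚof n
ℚof-+ m n = ℤof-homo-+ (+ m) (+ n)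

ℚof-* : ∀ m n → ℚof (m ℕ.* n) ≡ ℚof m * ℚof n
ℚof-* m n = trans (cong ℤof (ℤ.pos-* m n)) (ℤof-homo-* (+ m) (+ n))

-- Equality of unnormalised rationals is cross-multiplication, so the detour through `toℚᵘ` gives an
-- integer equation without unfolding a gcd.
ℚof*≡⇒ : ∀ q d m → q * ℚof d ≡ ℤof m → ℚ.↥ q ℤ.* + d ≡ m ℤ.* ℚ.↧ q
ℚof*≡⇒ q@record{} d m eq = begin
  ℚ.↥ q ℤ.* + d ≡⟨ ℤ.*-identityʳ _ ⟨
  ℚ.↥ q ℤ.* + d ℤ.* + 1 ≡⟨ ℚᵘ.drop-*≡* cross ⟩
  m ℤ.* (ℚ.↧ q ℤ.* + 1) ≡⟨ cong (m ℤ.*_) (ℤ.*-identityʳ (ℚ.↧ q)) ⟩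
  m ℤ.* ℚ.↧ q ∎
  where
  cross : ℚ.toℚᵘ q ℚᵘ.* ℚᵘ.mkℚᵘ (+ d) 0 ℚᵘ.≃ ℚᵘ.mkℚᵘ m 0
  cross = ℚᵘ.≃-trans (ℚᵘ.*-congˡ {ℚ.toℚᵘ q} (ℚᵘ.≃-sym (ℚ.toℚᵘ-fromℚᵘ (ℚᵘ.mkℚᵘ (+ d) 0))))
    (ℚᵘ.≃-trans (ℚᵘ.≃-sym (ℚ.toℚᵘ-homo-* q (ℚof d)))
    (ℚᵘ.≃-trans (ℚ.toℚᵘ-cong eq) (ℚ.toℚᵘ-fromℚᵘ (ℚᵘ.mkℚᵘ m 0))))

*↧≡↥ : ∀ q → q * ℚof (ℚ.↧ₙ q) ≡ ℤof (ℚ.↥ q)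
*↧≡↥ q@record{} = ℚ.toℚᵘ-injective
  (ℚᵘ.≃-trans (ℚ.toℚᵘ-homo-* q (ℚof (ℚ.↧ₙ q)))
  (ℚᵘ.≃-trans (ℚᵘ.*-congˡ {ℚ.toℚᵘ q} (ℚ.toℚᵘ-fromℚᵘ (ℚᵘ.mkℚᵘ (ℚ.↧ q) 0)))
  (ℚᵘ.≃-trans (ℚᵘ.*≡* cross) (ℚᵘ.≃-sym (ℚ.toℚᵘ-fromℚᵘ (ℚᵘ.mkℚᵘ (ℚ.↥ q) 0))))))
  where
  cross : ℚ.↥ q ℤ.* ℚ.↧ q ℤ.* + 1 ≡ ℚ.↥ q ℤ.* (ℚ.↧ q ℤ.* + 1)
  cross = ℤ.*-assoc (ℚ.↥ q) (ℚ.↧ q) (+ 1)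

-- The reduced denominator divides numerator times `d` and is coprime to the numerator. Hence any
-- denominator prime to p that clears `q` certifies `InZp`.
↧∣ : ∀ q d m → q * ℚof d ≡ ℤof m → ℚ.↧ₙ q ∣ d
↧∣ q@(ℚ.mkℚ n e c) d m eq = Coprimality.coprime-divisor (Coprimality.sym (Coprimality.recompute c)) (divides ℤ.∣ m ∣ (begin
  ℤ.∣ n ∣ ℕ.* d ≡⟨ ℤ.abs-* n (+ d) ⟨
  ℤ.∣ n ℤ.* + d ∣ ≡⟨ cong ℤ.∣_∣ (ℚof*≡⇒ q d m eq) ⟩
  ℤ.∣ m ℤ.* + suc e ∣ ≡⟨ ℤ.abs-* m (+ suc e) ⟩
  ℤ.∣ m ∣ ℕ.* suc e ∎))

recip : ℕ → ℚ
recip k = + 1 / suc k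

recip-inverse : ∀ k → ℚof (suc k) * recip k ≡ 1ℚ
recip-inverse k = begin
  ℚof (suc k) * recip k ≡⟨ ℚ.*-comm (ℚof (suc k)) (recip k) ⟩
  recip k * ℚof (suc k) ≡⟨ cong (_* ℚof (suc k)) (ℚ.normalize-coprime 1-coprime) ⟩
  ℚ.mkℚ (+ 1) k 1-coprime * ℚof (suc k) ≡⟨ *↧≡↥ (ℚ.mkℚ (+ 1) k 1-coprime) ⟩
  1ℚ ∎
  where
  1-coprime : Coprimality.Coprime 1 (suc k)
  1-coprime = Coprimality.1-coprimeTo (suc k)

ℚof-suc-cancelˡ : ∀ k {a b} → ℚof (suc k) * a ≡ ℚof (suc k) * b → a ≡ b
ℚof-suc-cancelˡ k {a} {b} eq = begin
  a ≡⟨ insert a ⟩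
  recip k * (ℚof (suc k) * a) ≡⟨ cong (recip k *_) eq ⟩
  recip k * (ℚof (suc k) * b) ≡⟨ insert b ⟨
  b ∎
  where
  regroup : ∀ s t c → s * t * c ≡ t * (s * c)
  regroup = solve-∀ ringℚ
  insert : ∀ c → c ≡ recip k * (ℚof (suc k) * c)
  insert c = begin
    c ≡⟨ ℚ.*-identityˡ c ⟨
    1ℚ * c ≡⟨ cong (_* c) (recip-inverse k) ⟨
    ℚof (suc k) * recip k * c ≡⟨ regroup (ℚof (suc k)) (recip k) c ⟩
    recip k * (ℚof (suc k) * c) ∎

-- Finite sums

Σ<-cong : ∀ n {f g} → (∀ {i} → i < n → f i ≡ g i) → Σ< n f ≡ Σ< n g
Σ<-cong zero    f≡g = refl
Σ<-cong (suc n) f≡g = cong₂ _+_ (Σ<-cong n (λ i<n → f≡g (ℕ.m<n⇒m<1+n i<n))) (f≡g (ℕ.n<1+n n))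

Σ<-+ : ∀ n f g → Σ< n (λ i → f i + g i) ≡ Σ< n f + Σ< n g
Σ<-+ zero    f g = refl
Σ<-+ (suc n) f g = begin
  Σ< n (λ i → f i + g i) + (f n + g n) ≡⟨ cong (_+ (f n + g n)) (Σ<-+ n f g) ⟩
  Σ< n f + Σ< n g + (f n + g n)        ≡⟨ interchange (Σ< n f) (Σ< n g) (f n) (g n) ⟩
  Σ< n f + f n + (Σ< n g + g n)        ∎
  where
  interchange : ∀ a b c d → a + b + (c + d) ≡ a + c + (b + d)
  interchange = solve-∀ ringℚ

Σ<-neg : ∀ n f → Σ< n (λ i → - f i) ≡ - Σ< n f
Σ<-neg zero    f = refl
Σ<-neg (suc n) f = trans (cong (_- f n) (Σ<-neg n f)) (sym (ℚ.neg-distrib-+ (Σ< n f) (f n)))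

Σ<-head : ∀ n f → Σ< (suc n) f ≡ f 0 + Σ< n (λ i → f (suc i))
Σ<-head zero    f = ℚ.+-comm 0ℚ (f 0)
Σ<-head (suc n) f = begin
  Σ< (suc n) f + f (suc n)                       ≡⟨ cong (_+ f (suc n)) (Σ<-head n f) ⟩
  f 0 + Σ< n (λ i → f (suc i)) + f (suc n)       ≡⟨ ℚ.+-assoc (f 0) _ _ ⟩
  f 0 + (Σ< n (λ i → f (suc i)) + f (suc n))     ∎

Σ≤≡Σ< : ∀ n f → Σ≤ n f ≡ Σ< (suc n) f
Σ≤≡Σ< zero    f = sym (ℚ.+-identityˡ (f 0))
Σ≤≡Σ< (suc n) f = cong (_+ f (suc n)) (Σ≤≡Σ< n f)

Σ<-zeroTail : ∀ {m n} f → m ℕ.≤′ n → (∀ {i} → m ℕ.≤ i → f i ≡ 0ℚ) → Σ< n f ≡ Σ< m f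
Σ<-zeroTail f ℕ.≤′-refl        f≡0 = refl
Σ<-zeroTail {m} {suc n} f (ℕ.≤′-step m≤n) f≡0 = begin
  Σ< n f + f n ≡⟨ cong₂ _+_ (Σ<-zeroTail f m≤n f≡0) (f≡0 (ℕ.≤′⇒≤ m≤n)) ⟩
  Σ< m f + 0ℚ  ≡⟨ ℚ.+-identityʳ (Σ< m f) ⟩
  Σ< m f       ∎

-- Generalised binomial coefficients

binom-step : ∀ y k → ℚof (suc k) * binom y (suc k) ≡ binom y k * (y - ℚof k)
binom-step y k = begin
  ℚof (suc k) * (binom y k * (y - ℚof k) * recip k)  ≡⟨ regroup (ℚof (suc k)) _ (recip k) ⟩
  ℚof (suc k) * recip k * (binom y k * (y - ℚof k))  ≡⟨ cong (_* (binom y k * (y - ℚof k))) (recip-inverse k) ⟩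
  1ℚ * (binom y k * (y - ℚof k))                     ≡⟨ ℚ.*-identityˡ _ ⟩
  binom y k * (y - ℚof k)                            ∎
  where
  regroup : ∀ s b t → s * (b * t) ≡ s * t * b
  regroup = solve-∀ ringℚ

-- Induction on `k`: an extra factor `suc k` exposes the product recursion on both sides. Pascal's
-- rule for a rational upper argument is then derived from this identity and y + 1 = (k + 1) + (y -
-- k).
binom-absorb : ∀ y k → ℚof (suc k) * binom (y + 1ℚ) (suc k) ≡ (y + 1ℚ) * binom y k
binom-absorb y zero    = trans (binom-step (y + 1ℚ) 0) (base y)
  where
  base : ∀ y → 1ℚ * (y + 1ℚ - 0ℚ) ≡ (y + 1ℚ) * 1ℚ
  base = solve-∀ ringℚ
binom-absorb y (suc k) = ℚof-suc-cancelˡ k (begin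
  K * (ℚof (suc (suc k)) * binom (y + 1ℚ) (suc (suc k)))  ≡⟨ cong (K *_) (binom-step (y + 1ℚ) (suc k)) ⟩
  K * (binom (y + 1ℚ) (suc k) * (y + 1ℚ - K))            ≡⟨ ℚ.*-assoc K _ _ ⟨
  K * binom (y + 1ℚ) (suc k) * (y + 1ℚ - K)              ≡⟨ cong₂ (λ a b → a * (y + 1ℚ - b)) (binom-absorb y k) (ℚof-suc k) ⟩
  (y + 1ℚ) * binom y k * (y + 1ℚ - (ℚof k + 1ℚ))         ≡⟨ shift y (binom y k) (ℚof k) ⟩
  (y + 1ℚ) * (binom y k * (y - ℚof k))                   ≡⟨ cong ((y + 1ℚ) *_) (binom-step y k) ⟨
  (y + 1ℚ) * (K * binom y (suc k))                       ≡⟨ regroup (y + 1ℚ) K _ ⟩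
  K * ((y + 1ℚ) * binom y (suc k))                       ∎)
  where
  K = ℚof (suc k)
  shift : ∀ y b k → (y + 1ℚ) * b * (y + 1ℚ - (k + 1ℚ)) ≡ (y + 1ℚ) * (b * (y - k))
  shift = solve-∀ ringℚ
  regroup : ∀ a b c → a * (b * c) ≡ b * (a * c)
  regroup = solve-∀ ringℚ

binom-pascal : ∀ y k → binom (y + 1ℚ) (suc k) ≡ binom y k + binom y (suc k)
binom-pascal y k = ℚof-suc-cancelˡ k (begin
  K * binom (y + 1ℚ) (suc k)                         ≡⟨ binom-absorb y k ⟩
  (y + 1ℚ) * binom y k                               ≡⟨ split y (ℚof k) (binom y k) ⟩
  (ℚof k + 1ℚ) * binom y k + binom y k * (y - ℚof k) ≡⟨ cong₂ (λ a b → a * binom y k + b) (ℚof-suc k) (binom-step y k) ⟨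
  K * binom y k + K * binom y (suc k)                ≡⟨ ℚ.*-distribˡ-+ K _ _ ⟨
  K * (binom y k + binom y (suc k))                  ∎)
  where
  K = ℚof (suc k)
  split : ∀ y k b → (y + 1ℚ) * b ≡ (k + 1ℚ) * b + b * (y - k)
  split = solve-∀ ringℚ

binom-0 : ∀ k → binom 0ℚ (suc k) ≡ 0ℚ
binom-0 zero    = refl
binom-0 (suc k) = begin
  binom 0ℚ (suc k) * (0ℚ - ℚof (suc k)) * recip (suc k) ≡⟨ cong (λ b → b * (0ℚ - ℚof (suc k)) * recip (suc k)) (binom-0 k) ⟩
  0ℚ * (0ℚ - ℚof (suc k)) * recip (suc k)               ≡⟨ annihilate (0ℚ - ℚof (suc k)) (recip (suc k)) ⟩
  0ℚ ∎
  where
  annihilate : ∀ a b → 0ℚ * a * b ≡ 0ℚ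
  annihilate = solve-∀ ringℚ

binom-ℚof : ∀ n k → binom (ℚof n) k ≡ ℚof (n C k)
binom-ℚof zero    zero    = refl
binom-ℚof zero    (suc k) = trans (binom-0 k) (cong ℚof (sym (k>n⇒nCk≡0 {0} {suc k} ℕ.z<s)))
binom-ℚof (suc n) zero    = cong ℚof (sym (trans (nCk≡nC[n∸k] {0} {suc n} ℕ.z≤n) (nCn≡1 (suc n))))
binom-ℚof (suc n) (suc k) = begin
  binom (ℚof (suc n)) (suc k)               ≡⟨ cong (λ y → binom y (suc k)) (ℚof-suc n) ⟩
  binom (ℚof n + 1ℚ) (suc k)                ≡⟨ binom-pascal (ℚof n) k ⟩
  binom (ℚof n) k + binom (ℚof n) (suc k)   ≡⟨ cong₂ _+_ (binom-ℚof n k) (binom-ℚof n (suc k)) ⟩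
  ℚof (n C k) + ℚof (n C suc k)             ≡⟨ ℚof-+ (n C k) (n C suc k) ⟨
  ℚof (n C k ℕ.+ n C suc k)                 ≡⟨ cong ℚof (nCk+nC[k+1]≡[n+1]C[k+1] n k) ⟩
  ℚof (suc n C suc k)                       ∎

binom-vanishes : ∀ {n k} → n < k → binom (ℚof n) k ≡ 0ℚ
binom-vanishes {n} {k} n<k = trans (binom-ℚof n k) (cong ℚof (k>n⇒nCk≡0 n<k))

binom-full : ∀ n → binom (ℚof n) n ≡ 1ℚ
binom-full n = trans (binom-ℚof n n) (cong ℚof (nCn≡1 n))

-- Supplies C(p-1,k) ≡ (-1)^k modulo p, because p-1 ≡ -1.
binom-[-1] : ∀ k → binom (- 1ℚ) k ≡ (- 1ℚ) ^ k
binom-[-1] zero    = refl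
binom-[-1] (suc k) = ℚof-suc-cancelˡ k (begin
  K * binom (- 1ℚ) (suc k)           ≡⟨ binom-step (- 1ℚ) k ⟩
  binom (- 1ℚ) k * (- 1ℚ - ℚof k)    ≡⟨ cong (_* (- 1ℚ - ℚof k)) (binom-[-1] k) ⟩
  (- 1ℚ) ^ k * (- 1ℚ - ℚof k)        ≡⟨ flip ((- 1ℚ) ^ k) (ℚof k) ⟩
  (ℚof k + 1ℚ) * (- 1ℚ * (- 1ℚ) ^ k) ≡⟨ cong (_* (- 1ℚ * (- 1ℚ) ^ k)) (ℚof-suc k) ⟨
  K * (- 1ℚ * (- 1ℚ) ^ k)            ∎)
  where
  K = ℚof (suc k)
  flip : ∀ s k → s * (- 1ℚ - k) ≡ (k + 1ℚ) * (- 1ℚ * s)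
  flip = solve-∀ ringℚ

-- The exact evaluation of the sum

-- Kept apart from its sign: modulo p the signs of C(p-1,k) and u_{k+1} multiply to the constant -1,
-- leaving a sum of these unsigned products.
w : ℕ → ℚ → ℚ
w k x = binom x k * binom (- 1ℚ - x) k

u : ℕ → ℚ → ℚ
u k x = (- 1ℚ) ^ k * w k x

-- The two new factors multiply to (x - k)(-1 - x - k) = k(k+1) - x(x+1).
u-step : ∀ k x → x * (x + 1ℚ) * u k x ≡ ℚof (suc k) * ℚof (suc k) * u (suc k) x + ℚof k * ℚof (suc k) * u k x
u-step k x = sym (begin
  K * K * (- 1ℚ * s * (binom x (suc k) * binom (- 1ℚ - x) (suc k))) + ℚof k * K * u k x
    ≡⟨ cong (_+ ℚof k * K * u k x) (regroup K s _ _) ⟩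
  - (s * ((K * binom x (suc k)) * (K * binom (- 1ℚ - x) (suc k)))) + ℚof k * K * u k x
    ≡⟨ cong₂ (λ a b → - (s * (a * b)) + ℚof k * K * u k x) (binom-step x k) (binom-step (- 1ℚ - x) k) ⟩
  - (s * ((A * (x - ℚof k)) * (B * (- 1ℚ - x - ℚof k)))) + ℚof k * K * u k x
    ≡⟨ cong (λ K → - (s * ((A * (x - ℚof k)) * (B * (- 1ℚ - x - ℚof k)))) + ℚof k * K * u k x) (ℚof-suc k) ⟩
  - (s * ((A * (x - ℚof k)) * (B * (- 1ℚ - x - ℚof k)))) + ℚof k * (ℚof k + 1ℚ) * u k x
    ≡⟨ factor s A B x (ℚof k) ⟩
  x * (x + 1ℚ) * u k x ∎)
  where
  K = ℚof (suc k)
  s = (- 1ℚ) ^ k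
  A = binom x k
  B = binom (- 1ℚ - x) k
  regroup : ∀ K s a b → K * K * (- 1ℚ * s * (a * b)) ≡ - (s * ((K * a) * (K * b)))
  regroup = solve-∀ ringℚ
  factor : ∀ s A B x k → - (s * ((A * (x - k)) * (B * (- 1ℚ - x - k)))) + k * (k + 1ℚ) * (s * (A * B)) ≡ x * (x + 1ℚ) * (s * (A * B))
  factor = solve-∀ ringℚ

-- Terms beyond `n` vanish, so all G_n can be given a common length `m` and added term by term.
G-extended : ∀ {n m} x → n < m → G n x ≡ Σ< m (λ k → binom (ℚof n) k * u k x)
G-extended {n} {m} x n<m = begin
  G n x                                         ≡⟨ Σ≤≡Σ< n _ ⟩
  Σ< (suc n) (λ k → ℚof (n C k) * ((- 1ℚ) ^ k) * binom x k * binom (- 1ℚ - x) k)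
    ≡⟨ Σ<-cong (suc n) (λ {k} _ → trans (regroup (ℚof (n C k)) ((- 1ℚ) ^ k) (binom x k) _) (cong (_* u k x) (sym (binom-ℚof n k)))) ⟩
  Σ< (suc n) (λ k → binom (ℚof n) k * u k x)
    ≡⟨ Σ<-zeroTail _ (ℕ.≤⇒≤′ n<m) (λ {k} n<k → trans (cong (_* u k x) (binom-vanishes n<k)) (ℚ.*-zeroˡ (u k x))) ⟨
  Σ< m (λ k → binom (ℚof n) k * u k x)          ∎
  where
  regroup : ∀ a b c d → a * b * c * d ≡ a * (b * (c * d))
  regroup = solve-∀ ringℚ

-- This is the exchange of summations with Σ_{i<n} C(i,k) = C(n,k+1), done as an induction on `n` in
-- which Pascal's rule takes up the new G_n.
ΣG-hockeyStick : ∀ {n m} x → n ℕ.≤ m → Σ< n (λ i → G i x) ≡ Σ< m (λ k → binom (ℚof n) (suc k) * u k x)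
ΣG-hockeyStick {zero}  {m} x _   = sym (trans
  (Σ<-cong m (λ {k} _ → trans (cong (_* u k x) (binom-0 k)) (ℚ.*-zeroˡ (u k x))))
  (Σ<-zeroTail {0} {m} (λ _ → 0ℚ) (ℕ.≤⇒≤′ ℕ.z≤n) (λ _ → refl)))
ΣG-hockeyStick {suc n} {m} x n<m = begin
  Σ< n (λ i → G i x) + G n x
    ≡⟨ cong₂ _+_ (ΣG-hockeyStick x (ℕ.<⇒≤ n<m)) (G-extended x n<m) ⟩
  Σ< m (λ k → binom (ℚof n) (suc k) * u k x) + Σ< m (λ k → binom (ℚof n) k * u k x)
    ≡⟨ Σ<-+ m _ _ ⟨
  Σ< m (λ k → binom (ℚof n) (suc k) * u k x + binom (ℚof n) k * u k x)
    ≡⟨ Σ<-cong m (λ {k} _ → pascal k) ⟩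
  Σ< m (λ k → binom (ℚof (suc n)) (suc k) * u k x) ∎
  where
  regroup : ∀ a b c → a * c + b * c ≡ (b + a) * c
  regroup = solve-∀ ringℚ
  pascal : ∀ k → binom (ℚof n) (suc k) * u k x + binom (ℚof n) k * u k x ≡ binom (ℚof (suc n)) (suc k) * u k x
  pascal k = begin
    binom (ℚof n) (suc k) * u k x + binom (ℚof n) k * u k x ≡⟨ regroup (binom (ℚof n) (suc k)) (binom (ℚof n) k) (u k x) ⟩
    (binom (ℚof n) k + binom (ℚof n) (suc k)) * u k x       ≡⟨ cong (_* u k x) (binom-pascal (ℚof n) k) ⟨
    binom (ℚof n + 1ℚ) (suc k) * u k x                      ≡⟨ cong (λ y → binom y (suc k) * u k x) (ℚof-suc n) ⟨
    binom (ℚof (suc n)) (suc k) * u k x                     ∎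

-- The last term is the boundary term of the telescoping; it vanishes for y + 1 = m.
Σ-binom-u : ∀ y x m → x * (x + 1ℚ) * Σ< m (λ k → binom (y + 1ℚ) (suc k) * u k x)
  ≡ (y + 1ℚ) * (y + 1ℚ) * Σ< m (λ k → binom y k * u (suc k) x) - ℚof m * ℚof (suc m) * binom (y + 1ℚ) (suc m) * u m x
Σ-binom-u y x zero = base (x * (x + 1ℚ)) ((y + 1ℚ) * (y + 1ℚ)) 1ℚ (binom (y + 1ℚ) 1) (u 0 x)
  where
  base : ∀ a b c d e → a * 0ℚ ≡ b * 0ℚ - 0ℚ * c * d * e
  base = solve-∀ ringℚ
Σ-binom-u y x (suc m) = begin
  a * (Σ₁ + B * u m x)
    ≡⟨ distrib a Σ₁ B (u m x) ⟩
  a * Σ₁ + B * (a * u m x)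
    ≡⟨ cong₂ (λ s t → s + B * t) (Σ-binom-u y x m) (u-step m x) ⟩
  Y * Y * Σ₂ - ℚof m * M * B * u m x + B * (M * M * u (suc m) x + ℚof m * M * u m x)
    ≡⟨ cancel (Y * Y * Σ₂) (ℚof m) M B (u m x) (u (suc m) x) ⟩
  Y * Y * Σ₂ + M * (M * B) * u (suc m) x
    -- Writing one factor `M` as `Y - (Y - M)` splits `M * (M * B)`: absorption makes the first part
    -- the new summand, and `binom-step` makes the second the new boundary term.
    ≡⟨ refold Y Σ₂ B M (u (suc m) x) ⟩
  Y * Y * Σ₂ + (Y * (M * B) - M * (B * (Y - M))) * u (suc m) x
    ≡⟨ cong₂ (λ s t → Y * Y * Σ₂ + (Y * s - M * t) * u (suc m) x) (binom-absorb y m) (sym (binom-step Y (suc m))) ⟩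
  Y * Y * Σ₂ + (Y * (Y * binom y m) - M * (ℚof (suc (suc m)) * binom Y (suc (suc m)))) * u (suc m) x
    ≡⟨ collect Y Σ₂ (binom y m) M (ℚof (suc (suc m))) (binom Y (suc (suc m))) (u (suc m) x) ⟩
  Y * Y * (Σ₂ + binom y m * u (suc m) x) - M * ℚof (suc (suc m)) * binom Y (suc (suc m)) * u (suc m) x ∎
  where
  a = x * (x + 1ℚ)
  Y = y + 1ℚ
  M = ℚof (suc m)
  B = binom Y (suc m)
  Σ₁ = Σ< m (λ k → binom (y + 1ℚ) (suc k) * u k x)
  Σ₂ = Σ< m (λ k → binom y k * u (suc k) x)
  distrib : ∀ a s b v → a * (s + b * v) ≡ a * s + b * (a * v)
  distrib = solve-∀ ringℚ
  cancel : ∀ s m M B v w → s - m * M * B * v + B * (M * M * w + m * M * v) ≡ s + M * (M * B) * w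
  cancel = solve-∀ ringℚ
  refold : ∀ Y s B M w → Y * Y * s + M * (M * B) * w ≡ Y * Y * s + (Y * (M * B) - M * (B * (Y - M))) * w
  refold = solve-∀ ringℚ
  collect : ∀ Y s b M N c w → Y * Y * s + (Y * (Y * b) - M * (N * c)) * w ≡ Y * Y * (s + b * w) - M * N * c * w
  collect = solve-∀ ringℚ

ΣG-exact : ∀ m x → x * (x + 1ℚ) * Σ< (suc m) (λ n → G n x)
  ≡ ℚof (suc m) * ℚof (suc m) * Σ< (suc m) (λ k → binom (ℚof m) k * u (suc k) x)
ΣG-exact m x = begin
  x * (x + 1ℚ) * Σ< (suc m) (λ n → G n x)
    ≡⟨ cong (x * (x + 1ℚ) *_) (ΣG-hockeyStick {suc m} {suc m} x ℕ.≤-refl) ⟩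
  x * (x + 1ℚ) * Σ< (suc m) (λ k → binom (ℚof (suc m)) (suc k) * u k x)
    ≡⟨ cong (λ M → x * (x + 1ℚ) * Σ< (suc m) (λ k → binom M (suc k) * u k x)) (ℚof-suc m) ⟩
  x * (x + 1ℚ) * Σ< (suc m) (λ k → binom (ℚof m + 1ℚ) (suc k) * u k x)
    ≡⟨ Σ-binom-u (ℚof m) x (suc m) ⟩
  (ℚof m + 1ℚ) * (ℚof m + 1ℚ) * S - c * binom (ℚof m + 1ℚ) (suc (suc m)) * u (suc m) x
    ≡⟨ cong (λ M → M * M * S - c * binom M (suc (suc m)) * u (suc m) x) (ℚof-suc m) ⟨
  ℚof (suc m) * ℚof (suc m) * S - c * binom (ℚof (suc m)) (suc (suc m)) * u (suc m) x
    ≡⟨ cong (λ b → ℚof (suc m) * ℚof (suc m) * S - c * b * u (suc m) x) (binom-vanishes (ℕ.n<1+n (suc m))) ⟩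
  ℚof (suc m) * ℚof (suc m) * S - c * 0ℚ * u (suc m) x
    ≡⟨ drop (ℚof (suc m) * ℚof (suc m) * S) c (u (suc m) x) ⟩
  ℚof (suc m) * ℚof (suc m) * S ∎
  where
  S = Σ< (suc m) (λ k → binom (ℚof m) k * u (suc k) x)
  c = ℚof (suc m) * ℚof (suc (suc m))
  drop : ∀ s c v → s - c * 0ℚ * v ≡ s
  drop = solve-∀ ringℚ

-- The sum of the w k at a natural number

-- The sums at x and x+1 are paired because their total has a closed form containing C(x,n). At a
-- natural number below n this factor is zero, so the two sums are opposite.
Σw-step : ∀ n x → Σ< (suc n) (λ k → w k (x + 1ℚ)) + Σ< (suc n) (λ k → w k x)
  ≡ (1ℚ + 1ℚ) * (binom x n * binom (- 1ℚ - (x + 1ℚ)) n)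
Σw-step zero    x = refl
Σw-step (suc n) x = begin
  (S₁ + (binom (x + 1ℚ) (suc n) * B')) + (S₂ + A' * binom (- 1ℚ - x) (suc n))
    ≡⟨ cong₂ (λ a b → (S₁ + (a * B')) + (S₂ + A' * b)) (binom-pascal x n) (trans (cong (λ y → binom y (suc n)) (reflect x)) (binom-pascal z n)) ⟩
  (S₁ + ((A + A') * B')) + (S₂ + A' * (B + B'))
    ≡⟨ regroup S₁ S₂ A A' B B' ⟩
  (S₁ + S₂) + (A * B' + A' * B) + (1ℚ + 1ℚ) * (A' * B')
    ≡⟨ cong₂ (λ s t → s + t + (1ℚ + 1ℚ) * (A' * B')) (Σw-step n x) mixed ⟩
  (1ℚ + 1ℚ) * (A * B) + - ((1ℚ + 1ℚ) * (A * B)) + (1ℚ + 1ℚ) * (A' * B')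
    ≡⟨ cancel (A * B) (A' * B') ⟩
  (1ℚ + 1ℚ) * (A' * B') ∎
  where
  z = - 1ℚ - (x + 1ℚ)
  A = binom x n
  A' = binom x (suc n)
  B = binom z n
  B' = binom z (suc n)
  S₁ = Σ< (suc n) (λ k → w k (x + 1ℚ))
  S₂ = Σ< (suc n) (λ k → w k x)
  reflect : ∀ x → - 1ℚ - x ≡ - 1ℚ - (x + 1ℚ) + 1ℚ
  reflect = solve-∀ ringℚ
  regroup : ∀ s t A A' B B' → (s + ((A + A') * B')) + (t + A' * (B + B')) ≡ (s + t) + (A * B' + A' * B) + (1ℚ + 1ℚ) * (A' * B')
  regroup = solve-∀ ringℚ
  cancel : ∀ a b → (1ℚ + 1ℚ) * a + - ((1ℚ + 1ℚ) * a) + (1ℚ + 1ℚ) * b ≡ (1ℚ + 1ℚ) * b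
  cancel = solve-∀ ringℚ
  distrib : ∀ K A A' B B' → K * (A * B' + A' * B) ≡ A * (K * B') + (K * A') * B
  distrib = solve-∀ ringℚ
  collapse : ∀ A B x n → A * (B * (- 1ℚ - (x + 1ℚ) - n)) + A * (x - n) * B ≡ (n + 1ℚ) * - ((1ℚ + 1ℚ) * (A * B))
  collapse = solve-∀ ringℚ
  -- By `binom-step` both products are multiples of `A * B`, with factors z - n and x - n over n +
  -- 1; since z = -2 - x these factors add up to -2(n+1).
  mixed : A * B' + A' * B ≡ - ((1ℚ + 1ℚ) * (A * B))
  mixed = ℚof-suc-cancelˡ n (begin
    ℚof (suc n) * (A * B' + A' * B)
      ≡⟨ distrib (ℚof (suc n)) A A' B B' ⟩
    A * (ℚof (suc n) * B') + (ℚof (suc n) * A') * B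
      ≡⟨ cong₂ (λ s t → A * s + t * B) (binom-step z n) (binom-step x n) ⟩
    A * (B * (z - ℚof n)) + A * (x - ℚof n) * B
      ≡⟨ collapse A B x (ℚof n) ⟩
    (ℚof n + 1ℚ) * - ((1ℚ + 1ℚ) * (A * B))
      ≡⟨ cong (_* - ((1ℚ + 1ℚ) * (A * B))) (ℚof-suc n) ⟨
    ℚof (suc n) * - ((1ℚ + 1ℚ) * (A * B)) ∎)

-- At r = 0 only the term k = 0 survives; each later step flips the sign, as C(r,n) = 0 for r < n in
-- `Σw-step`.
Σw-ℚof : ∀ {n r} → r ℕ.≤ n → Σ< (suc n) (λ k → w k (ℚof r)) ≡ (- 1ℚ) ^ r
Σw-ℚof {n} {zero} _ = Σ<-zeroTail {1} {suc n} (λ k → w k 0ℚ) (ℕ.≤⇒≤′ (ℕ.s≤s ℕ.z≤n)) vanish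
  where
  vanish : ∀ {i} → 1 ℕ.≤ i → w i 0ℚ ≡ 0ℚ
  vanish {suc i} _ = trans (cong (_* binom (- 1ℚ - 0ℚ) (suc i)) (binom-0 i)) (ℚ.*-zeroˡ (binom (- 1ℚ - 0ℚ) (suc i)))
Σw-ℚof {n} {suc r} r<n = begin
  Σ< (suc n) (λ k → w k (ℚof (suc r)))
    ≡⟨ cong (λ y → Σ< (suc n) (λ k → w k y)) (ℚof-suc r) ⟩
  S
    ≡⟨ isolate S T ⟩
  (S + T) - T
    ≡⟨ cong₂ _-_ (Σw-step n (ℚof r)) (Σw-ℚof (ℕ.<⇒≤ r<n)) ⟩
  (1ℚ + 1ℚ) * (binom (ℚof r) n * B) - (- 1ℚ) ^ r
    ≡⟨ cong (λ b → (1ℚ + 1ℚ) * (b * B) - (- 1ℚ) ^ r) (binom-vanishes r<n) ⟩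
  (1ℚ + 1ℚ) * (0ℚ * B) - (- 1ℚ) ^ r
    ≡⟨ simplify B ((- 1ℚ) ^ r) ⟩
  (- 1ℚ) ^ suc r ∎
  where
  S = Σ< (suc n) (λ k → w k (ℚof r + 1ℚ))
  T = Σ< (suc n) (λ k → w k (ℚof r))
  B = binom (- 1ℚ - (ℚof r + 1ℚ)) n
  isolate : ∀ s t → s ≡ (s + t) - t
  isolate = solve-∀ ringℚ
  simplify : ∀ b s → (1ℚ + 1ℚ) * (0ℚ * b) - s ≡ - 1ℚ * s
  simplify = solve-∀ ringℚ

-- Congruences modulo a prime in the ring of p-integral rationals

-- With the prime written as `suc m`, p-1 is `m` and 1/p is `recip m`.
module ModPrime (m : ℕ) (p-prime : Prime (suc m)) where

  p : ℕ
  p = suc m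

  P : ℚ
  P = ℚof p

  -- Any clearing denominator prime to p is accepted, reduced or not. Closure under sums and
  -- products is then a matter of multiplying denominators, by Euclid's lemma.
  record Integral (q : ℚ) : Set where
    constructor integral
    field
      den     : ℕ
      p∤den   : ¬ (p ∣ den)
      num     : ℤ.ℤ
      cleared : q * ℚof den ≡ ℤof num

  InZp⇒Integral : ∀ {q} → InZp p q → Integral q
  InZp⇒Integral {q} p∤↧q = integral (ℚ.↧ₙ q) p∤↧q (ℚ.↥ q) (*↧≡↥ q)

  Integral⇒InZp : ∀ {q} → Integral q → InZp p q
  Integral⇒InZp {q} (integral d p∤d n eq) p∣↧q = p∤d (ℕ.∣-trans p∣↧q (↧∣ q d n eq))

  p∤1 : ¬ (p ∣ 1)
  p∤1 p∣1 = ℕ.nonTrivial⇒≢1 {{prime⇒nonTrivial p-prime}} (ℕ.∣1⇒≡1 p∣1)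

  p∤* : ∀ {a b} → ¬ (p ∣ a) → ¬ (p ∣ b) → ¬ (p ∣ a ℕ.* b)
  p∤* {a} {b} p∤a p∤b p∣ab = [ p∤a , p∤b ]′ (euclidsLemma a b p-prime p∣ab)

  p∤suc : ∀ {k} → k < m → ¬ (p ∣ suc k)
  p∤suc k<m = ℕ.>⇒∤ (ℕ.s<s k<m)

  Integral-ℤof : ∀ i → Integral (ℤof i)
  Integral-ℤof i = integral 1 p∤1 i (ℚ.*-identityʳ (ℤof i))

  Integral-ℚof : ∀ n → Integral (ℚof n)
  Integral-ℚof n = Integral-ℤof (+ n)

  Integral-+ : ∀ {a b} → Integral a → Integral b → Integral (a + b)
  Integral-+ {a} {b} (integral d p∤d i eq) (integral e p∤e j eq′) =
    integral (d ℕ.* e) (p∤* p∤d p∤e) (i ℤ.* + e ℤ.+ j ℤ.* + d) (begin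
      (a + b) * ℚof (d ℕ.* e)                       ≡⟨ cong ((a + b) *_) (ℚof-* d e) ⟩
      (a + b) * (ℚof d * ℚof e)                     ≡⟨ regroup a b (ℚof d) (ℚof e) ⟩
      a * ℚof d * ℚof e + b * ℚof e * ℚof d         ≡⟨ cong₂ (λ s t → s * ℚof e + t * ℚof d) eq eq′ ⟩
      ℤof i * ℚof e + ℤof j * ℚof d                 ≡⟨ cong₂ _+_ (ℤof-homo-* i (+ e)) (ℤof-homo-* j (+ d)) ⟨
      ℤof (i ℤ.* + e) + ℤof (j ℤ.* + d)             ≡⟨ ℤof-homo-+ (i ℤ.* + e) (j ℤ.* + d) ⟨
      ℤof (i ℤ.* + e ℤ.+ j ℤ.* + d)                 ∎)
    where
    regroup : ∀ a b d e → (a + b) * (d * e) ≡ a * d * e + b * e * d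
    regroup = solve-∀ ringℚ

  Integral-* : ∀ {a b} → Integral a → Integral b → Integral (a * b)
  Integral-* {a} {b} (integral d p∤d i eq) (integral e p∤e j eq′) =
    integral (d ℕ.* e) (p∤* p∤d p∤e) (i ℤ.* j) (begin
      a * b * ℚof (d ℕ.* e)       ≡⟨ cong (a * b *_) (ℚof-* d e) ⟩
      a * b * (ℚof d * ℚof e)     ≡⟨ regroup a b (ℚof d) (ℚof e) ⟩
      a * ℚof d * (b * ℚof e)     ≡⟨ cong₂ _*_ eq eq′ ⟩
      ℤof i * ℤof j               ≡⟨ ℤof-homo-* i j ⟨
      ℤof (i ℤ.* j)               ∎)
    where
    regroup : ∀ a b d e → a * b * (d * e) ≡ a * d * (b * e)
    regroup = solve-∀ ringℚ

  Integral-neg : ∀ {a} → Integral a → Integral (- a)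
  Integral-neg {a} (integral d p∤d i eq) = integral d p∤d (ℤ.- i) (begin
    - a * ℚof d      ≡⟨ ℚ.neg-distribˡ-* a (ℚof d) ⟨
    - (a * ℚof d)    ≡⟨ cong -_ eq ⟩
    - ℤof i          ≡⟨ ℤof-homo-neg i ⟨
    ℤof (ℤ.- i)      ∎)

  Integral-− : ∀ {a b} → Integral a → Integral b → Integral (a - b)
  Integral-− ia ib = Integral-+ ia (Integral-neg ib)

  Integral-recip : ∀ {k} → ¬ (p ∣ suc k) → Integral (recip k)
  Integral-recip {k} p∤k = integral (suc k) p∤k (+ 1) (trans (ℚ.*-comm (recip k) (ℚof (suc k))) (recip-inverse k))

  infix 4 _≈_

  -- Congruence modulo p, with the difference solved for `a` so that it can be substituted directly.
  record _≈_ (a b : ℚ) : Set where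
    constructor congruent
    field
      quotient          : ℚ
      quotient-integral : Integral quotient
      difference        : a ≡ b + P * quotient

  ≈-reflexive : ∀ {a b} → a ≡ b → a ≈ b
  ≈-reflexive {a} {b} eq = congruent 0ℚ (Integral-ℚof 0) (trans eq (+*0 b P))
    where
    +*0 : ∀ b P → b ≡ b + P * 0ℚ
    +*0 = solve-∀ ringℚ

  ≈-trans : ∀ {a b c} → a ≈ b → b ≈ c → a ≈ c
  ≈-trans {a} {b} {c} (congruent q iq eq) (congruent q′ iq′ eq′) =
    congruent (q′ + q) (Integral-+ iq′ iq) (trans eq (trans (cong (_+ P * q) eq′) (regroup c P q q′)))
    where
    regroup : ∀ c P q q′ → c + P * q′ + P * q ≡ c + P * (q′ + q)
    regroup = solve-∀ ringℚ

  ≈-+ : ∀ {a b c d} → a ≈ b → c ≈ d → a + c ≈ b + d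
  ≈-+ {b = b} {d = d} (congruent q iq eq) (congruent q′ iq′ eq′) =
    congruent (q + q′) (Integral-+ iq iq′) (trans (cong₂ _+_ eq eq′) (regroup b d P q q′))
    where
    regroup : ∀ b d P q q′ → b + P * q + (d + P * q′) ≡ b + d + P * (q + q′)
    regroup = solve-∀ ringℚ

  ≈-* : ∀ {a b c d} → Integral b → Integral c → a ≈ b → c ≈ d → a * c ≈ b * d
  ≈-* {a} {b} {c} {d} ib ic (congruent q iq eq) (congruent q′ iq′ eq′) =
    congruent (q * c + b * q′) (Integral-+ (Integral-* iq ic) (Integral-* ib iq′)) (begin
      a * c                      ≡⟨ cong (_* c) eq ⟩
      (b + P * q) * c            ≡⟨ ℚ.*-distribʳ-+ c b (P * q) ⟩
      b * c + P * q * c          ≡⟨ cong (λ s → b * s + P * q * c) eq′ ⟩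
      b * (d + P * q′) + P * q * c ≡⟨ regroup b c d P q q′ ⟩
      b * d + P * (q * c + b * q′) ∎)
    where
    regroup : ∀ b c d P q q′ → b * (d + P * q′) + P * q * c ≡ b * d + P * (q * c + b * q′)
    regroup = solve-∀ ringℚ

  ≈-neg : ∀ {a b} → a ≈ b → - a ≈ - b
  ≈-neg {b = b} (congruent q iq eq) = congruent (- q) (Integral-neg iq) (trans (cong -_ eq) (regroup b P q))
    where
    regroup : ∀ b P q → - (b + P * q) ≡ - b + P * - q
    regroup = solve-∀ ringℚ

  Integral-resp-≈ : ∀ {a b} → a ≈ b → Integral b → Integral a
  Integral-resp-≈ (congruent q iq eq) ib = subst Integral (sym eq) (Integral-+ ib (Integral-* (Integral-ℚof p) iq))

  Σ<-≈ : ∀ n {f g} → (∀ {i} → i < n → f i ≈ g i) → Σ< n f ≈ Σ< n g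
  Σ<-≈ zero    f≈g = ≈-reflexive refl
  Σ<-≈ (suc n) f≈g = ≈-+ (Σ<-≈ n (λ i<n → f≈g (ℕ.m<n⇒m<1+n i<n))) (f≈g (ℕ.n<1+n n))

  Integral-binom : ∀ {y k} → Integral y → k < p → Integral (binom y k)
  Integral-binom {k = zero}  iy _   = Integral-ℚof 1
  Integral-binom {k = suc k} iy k<p = Integral-*
    (Integral-* (Integral-binom iy (ℕ.<⇒≤ k<p)) (Integral-− iy (Integral-ℚof k)))
    (Integral-recip (p∤suc (ℕ.s<s⁻¹ k<p)))

  -- As in `Integral-binom`, the bound k < p keeps every divisor 1, ..., k prime to p. At k = p the
  -- statement would fail, which is why `binom-p` is treated separately.
  binom-≈ : ∀ {y z k} → Integral z → y ≈ z → k < p → binom y k ≈ binom z k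
  binom-≈ {k = zero}  iz y≈z _   = ≈-reflexive refl
  binom-≈ {y} {z} {suc k} iz y≈z k<p =
    ≈-* (Integral-* (Integral-binom iz (ℕ.<⇒≤ k<p)) (Integral-− iz (Integral-ℚof k)))
      (Integral-recip (p∤suc (ℕ.s<s⁻¹ k<p)))
      (≈-* (Integral-binom iz (ℕ.<⇒≤ k<p)) (Integral-− (Integral-resp-≈ y≈z iz) (Integral-ℚof k))
        (binom-≈ iz y≈z (ℕ.<⇒≤ k<p)) (≈-+ y≈z (≈-reflexive refl)))
      (≈-reflexive refl)

  P*-≈0 : ∀ {t} b → Integral t → b + P * t ≈ b
  P*-≈0 {t} b it = congruent t it refl

  -- Dividing by p in C(pt, p) = t C(pt - 1, p - 1) starts an induction on r by Pascal's rule.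
  binom-p : ∀ {t} r → (- 1ℚ) ^ m ≡ 1ℚ → Integral t → r < p → binom (ℚof r + P * t) p ≈ t
  binom-p {t} zero sign it _ = ≈-trans (≈-reflexive absorb)
    (≈-trans (≈-* it (Integral-resp-≈ lower≈1 (Integral-ℚof 1)) (≈-reflexive refl) lower≈1) (≈-reflexive (ℚ.*-identityʳ t)))
    where
    -- Here -1 + p t ≡ -1, and C(-1,p-1) = (-1)^(p-1) is 1 by `sign`.
    lower≈1 : binom (- 1ℚ + P * t) m ≈ 1ℚ
    lower≈1 = ≈-trans (binom-≈ (Integral-ℤof -[1+ 0 ]) (P*-≈0 (- 1ℚ) it) (ℕ.n<1+n m))
      (≈-reflexive (trans (binom-[-1] m) sign))
    shift : ∀ P t → 0ℚ + P * t ≡ - 1ℚ + P * t + 1ℚ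
    shift = solve-∀ ringℚ
    regroup : ∀ P t b → (- 1ℚ + P * t + 1ℚ) * b ≡ P * (t * b)
    regroup = solve-∀ ringℚ
    absorb : binom (0ℚ + P * t) p ≡ t * binom (- 1ℚ + P * t) m
    absorb = ℚof-suc-cancelˡ m (begin
      P * binom (0ℚ + P * t) p                   ≡⟨ cong (λ y → P * binom y p) (shift P t) ⟩
      P * binom (- 1ℚ + P * t + 1ℚ) p            ≡⟨ binom-absorb (- 1ℚ + P * t) m ⟩
      (- 1ℚ + P * t + 1ℚ) * binom (- 1ℚ + P * t) m ≡⟨ regroup P t (binom (- 1ℚ + P * t) m) ⟩
      P * (t * binom (- 1ℚ + P * t) m)           ∎)
  binom-p {t} (suc r) sign it r<p = ≈-trans (≈-reflexive pascal)
    (≈-trans (≈-+ lower≈0 (binom-p r sign it (ℕ.<⇒≤ r<p))) (≈-reflexive (ℚ.+-identityˡ t)))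
    where
    y = ℚof r + P * t
    -- From suc r < p follows r < p-1, so C(r,p-1) = 0 and Pascal's rule adds nothing modulo p.
    lower≈0 : binom y m ≈ 0ℚ
    lower≈0 = ≈-trans (binom-≈ (Integral-ℚof r) (P*-≈0 (ℚof r) it) (ℕ.n<1+n m))
      (≈-reflexive (binom-vanishes (ℕ.s<s⁻¹ r<p)))
    shift : ∀ r s → r + 1ℚ + s ≡ r + s + 1ℚ
    shift = solve-∀ ringℚ
    pascal : binom (ℚof (suc r) + P * t) p ≡ binom y m + binom y p
    pascal = begin
      binom (ℚof (suc r) + P * t) p ≡⟨ cong (λ s → binom (s + P * t) p) (ℚof-suc r) ⟩
      binom (ℚof r + 1ℚ + P * t) p  ≡⟨ cong (λ s → binom s p) (shift (ℚof r) (P * t)) ⟩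
      binom (y + 1ℚ) p              ≡⟨ binom-pascal y m ⟩
      binom y m + binom y p         ∎

  -- The sum modulo p, and the lift to p³

  module Expansion (sign : (- 1ℚ) ^ m ≡ 1ℚ) {t : ℚ} (it : Integral t) {r : ℕ} (r<p : r < p) where

    R x value : ℚ
    R = ℚof r
    x = R + P * t
    value = t * (t + 1ℚ) + 1ℚ - (- 1ℚ) ^ r

    ix : Integral x
    ix = Integral-resp-≈ (P*-≈0 R it) (Integral-ℚof r)

    reflected : - 1ℚ - x ≡ ℚof (m ℕ.∸ r) + P * (- 1ℚ - t)
    reflected = begin
      - 1ℚ - (R + P * t)                              ≡⟨ cong (λ s → - 1ℚ - (R + s * t)) P-split ⟩
      - 1ℚ - (R + (ℚof (m ℕ.∸ r) + R + 1ℚ) * t)       ≡⟨ regroup (ℚof (m ℕ.∸ r)) R t ⟩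
      ℚof (m ℕ.∸ r) + (ℚof (m ℕ.∸ r) + R + 1ℚ) * (- 1ℚ - t) ≡⟨ cong (λ s → ℚof (m ℕ.∸ r) + s * (- 1ℚ - t)) P-split ⟨
      ℚof (m ℕ.∸ r) + P * (- 1ℚ - t)                  ∎
      where
      P-split : P ≡ ℚof (m ℕ.∸ r) + R + 1ℚ
      P-split = begin
        P                              ≡⟨ ℚof-suc m ⟩
        ℚof m + 1ℚ                     ≡⟨ cong (λ n → ℚof n + 1ℚ) (ℕ.m∸n+n≡m (ℕ.s≤s⁻¹ r<p)) ⟨
        ℚof (m ℕ.∸ r ℕ.+ r) + 1ℚ       ≡⟨ cong (_+ 1ℚ) (ℚof-+ (m ℕ.∸ r) r) ⟩
        ℚof (m ℕ.∸ r) + R + 1ℚ         ∎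
      regroup : ∀ s R t → - 1ℚ - (R + (s + R + 1ℚ) * t) ≡ s + (s + R + 1ℚ) * (- 1ℚ - t)
      regroup = solve-∀ ringℚ

    w-≈ : ∀ {k} → k < p → w k x ≈ w k R
    w-≈ k<p = ≈-* (Integral-binom (Integral-ℚof r) k<p) (Integral-binom (Integral-− (Integral-ℤof -[1+ 0 ]) ix) k<p)
      (binom-≈ (Integral-ℚof r) x≈R k<p)
      (binom-≈ (Integral-− (Integral-ℤof -[1+ 0 ]) (Integral-ℚof r)) (≈-+ (≈-reflexive { - 1ℚ} refl) (≈-neg x≈R)) k<p)
      where
      x≈R : x ≈ R
      x≈R = P*-≈0 R it

    Integral-sign : ∀ k → Integral ((- 1ℚ) ^ k)
    Integral-sign zero    = Integral-ℚof 1
    Integral-sign (suc k) = Integral-* (Integral-ℤof -[1+ 0 ]) (Integral-sign k)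

    sign-square : ∀ k → (- 1ℚ) ^ k * (- 1ℚ) ^ k ≡ 1ℚ
    sign-square zero    = refl
    sign-square (suc k) = trans (regroup ((- 1ℚ) ^ k)) (sign-square k)
      where
      regroup : ∀ s → - 1ℚ * s * (- 1ℚ * s) ≡ s * s
      regroup = solve-∀ ringℚ

    -- C(p-1,k) contributes (-1)^k and u_{k+1} contributes (-1)^(k+1), so a single minus sign
    -- remains for every k.
    summand-≈ : ∀ {k} → k < m → binom (ℚof m) k * u (suc k) x ≈ - w (suc k) R
    summand-≈ {k} k<m = ≈-trans
      (≈-* (Integral-sign k) iu binom≈sign (≈-* (Integral-sign (suc k)) iw (≈-reflexive refl) (w-≈ (ℕ.s<s k<m))))
      (≈-reflexive (trans (regroup ((- 1ℚ) ^ k) (w (suc k) R))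
        (trans (cong (λ s → - (s * w (suc k) R)) (sign-square k)) (cong -_ (ℚ.*-identityˡ (w (suc k) R))))))
      where
      iw : Integral (w (suc k) x)
      iw = Integral-* (Integral-binom ix (ℕ.s<s k<m)) (Integral-binom (Integral-− (Integral-ℤof -[1+ 0 ]) ix) (ℕ.s<s k<m))
      iu : Integral (u (suc k) x)
      iu = Integral-* (Integral-sign (suc k)) iw
      m≈-1 : ℚof m ≈ - 1ℚ
      m≈-1 = congruent 1ℚ (Integral-ℚof 1) (trans (shift (ℚof m)) (cong (λ s → - 1ℚ + s * 1ℚ) (sym (ℚof-suc m))))
        where
        shift : ∀ n → n ≡ - 1ℚ + (n + 1ℚ) * 1ℚ
        shift = solve-∀ ringℚ
      binom≈sign : binom (ℚof m) k ≈ (- 1ℚ) ^ k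
      binom≈sign = ≈-trans (binom-≈ (Integral-ℤof -[1+ 0 ]) m≈-1 (ℕ.m<n⇒m<1+n k<m)) (≈-reflexive (binom-[-1] k))
      regroup : ∀ s v → s * (- 1ℚ * s * v) ≡ - (s * s * v)
      regroup = solve-∀ ringℚ

    last-≈ : binom (ℚof m) m * u p x ≈ t * (t + 1ℚ)
    last-≈ = ≈-trans (≈-reflexive unfold) (≈-trans (≈-neg (≈-* it iB A≈t B≈)) (≈-reflexive (regroup t)))
      where
      A = binom x p
      B = binom (- 1ℚ - x) p
      A≈t : A ≈ t
      A≈t = binom-p r sign it r<p
      B≈ : B ≈ - 1ℚ - t
      B≈ = subst (λ y → binom y p ≈ - 1ℚ - t) (sym reflected)
        (binom-p (m ℕ.∸ r) sign (Integral-− (Integral-ℤof -[1+ 0 ]) it) (ℕ.s≤s (ℕ.m∸n≤m m r)))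
      iB : Integral B
      iB = Integral-resp-≈ B≈ (Integral-− (Integral-ℤof -[1+ 0 ]) it)
      regroup : ∀ t → - (t * (- 1ℚ - t)) ≡ t * (t + 1ℚ)
      regroup = solve-∀ ringℚ
      simplify : ∀ v → 1ℚ * (- 1ℚ * 1ℚ * v) ≡ - v
      simplify = solve-∀ ringℚ
      unfold : binom (ℚof m) m * u p x ≡ - (A * B)
      unfold = begin
        binom (ℚof m) m * (- 1ℚ * (- 1ℚ) ^ m * (A * B)) ≡⟨ cong₂ (λ b s → b * (- 1ℚ * s * (A * B))) (binom-full m) sign ⟩
        1ℚ * (- 1ℚ * 1ℚ * (A * B))                      ≡⟨ simplify (A * B) ⟩
        - (A * B)                                       ∎

    Σ-≈ : Σ< p (λ k → binom (ℚof m) k * u (suc k) x) ≈ value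
    Σ-≈ = ≈-trans (≈-+ (Σ<-≈ m summand-≈) last-≈) (≈-reflexive (begin
      Σ< m (λ k → - w (suc k) R) + t * (t + 1ℚ)            ≡⟨ cong (_+ t * (t + 1ℚ)) (Σ<-neg m (λ k → w (suc k) R)) ⟩
      - W + t * (t + 1ℚ)                                   ≡⟨ regroup W (t * (t + 1ℚ)) ⟩
      -- The added 1 is the missing term `w 0 R`, which completes `W` to the sum evaluated by
      -- `Σw-ℚof`.
      t * (t + 1ℚ) + 1ℚ - (1ℚ + W)                         ≡⟨ cong (λ s → t * (t + 1ℚ) + 1ℚ - s) (Σ<-head m (λ k → w k R)) ⟨
      t * (t + 1ℚ) + 1ℚ - Σ< p (λ k → w k R)               ≡⟨ cong (λ s → t * (t + 1ℚ) + 1ℚ - s) (Σw-ℚof (ℕ.s≤s⁻¹ r<p)) ⟩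
      value                                                ∎))
      where
      W = Σ< m (λ k → w (suc k) R)
      regroup : ∀ W v → - W + v ≡ v + 1ℚ - (1ℚ + W)
      regroup = solve-∀ ringℚ

    -- Multiplying the exact identity by the inverse `b` of x(x+1) isolates the sum; its factor p²
    -- raises the congruence modulo p to one modulo p³.
    ΣG-mod-p³ : ∀ {b} → Integral b → x * (x + 1ℚ) * b ≡ 1ℚ →
      Σ< p (λ n → G n x) ≡ (P ^ 2) * (value * b) [mod p ^ 3 ]
    ΣG-mod-p³ {b} ib ab≡1 = q * b , Integral⇒InZp (Integral-* iq ib) , (begin
      S - (P ^ 2) * (value * b)                      ≡⟨ cong (_- (P ^ 2) * (value * b)) expand ⟩
      P * P * (value + P * q) * b - (P ^ 2) * (value * b) ≡⟨ regroup P value q b ⟩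
      (P ^ 3) * (q * b)                              ∎)
      where
      open _≈_ Σ-≈ renaming (quotient to q; quotient-integral to iq)
      S = Σ< p (λ n → G n x)
      rotate : ∀ s a b → s * (a * b) ≡ a * s * b
      rotate = solve-∀ ringℚ
      regroup : ∀ P v q b → P * P * (v + P * q) * b - P * (P * 1ℚ) * (v * b) ≡ P * (P * (P * 1ℚ)) * (q * b)
      regroup = solve-∀ ringℚ
      expand : S ≡ P * P * (value + P * q) * b
      expand = begin
        S                             ≡⟨ ℚ.*-identityʳ S ⟨
        S * 1ℚ                        ≡⟨ cong (S *_) ab≡1 ⟨
        S * (x * (x + 1ℚ) * b)        ≡⟨ rotate S (x * (x + 1ℚ)) b ⟩
        x * (x + 1ℚ) * S * b          ≡⟨ cong (_* b) (ΣG-exact m x) ⟩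
        P * P * Σ< p (λ k → binom (ℚof m) k * u (suc k) x) * b ≡⟨ cong (λ s → P * P * s * b) difference ⟩
        P * P * (value + P * q) * b   ∎

  -- Units among the p-integral rationals

  naturalUnitOrMultiple : ∀ x d n → ¬ (p ∣ d) → x * ℚof d ≡ ℚof n → Dec (p ∣ n) →
    x ≈ 0ℚ ⊎ ∃[ b ] (Integral b × x * b ≡ 1ℚ)
  naturalUnitOrMultiple x d n p∤d eq (yes (divides c n≡cp)) =
    inj₁ (congruent (x * recip m) (integral d p∤d (+ c) scaled) (begin
      x                            ≡⟨ ℚ.*-identityʳ x ⟨
      x * 1ℚ                       ≡⟨ cong (x *_) (recip-inverse m) ⟨
      x * (P * recip m)            ≡⟨ regroup x P (recip m) ⟩
      0ℚ + P * (x * recip m)       ∎))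
    where
    regroup : ∀ x P s → x * (P * s) ≡ 0ℚ + P * (x * s)
    regroup = solve-∀ ringℚ
    swap : ∀ x s d → x * s * d ≡ x * d * s
    swap = solve-∀ ringℚ
    scaled : x * recip m * ℚof d ≡ ℚof c
    scaled = begin
      x * recip m * ℚof d    ≡⟨ swap x (recip m) (ℚof d) ⟩
      x * ℚof d * recip m    ≡⟨ cong (_* recip m) (trans eq (trans (cong ℚof n≡cp) (ℚof-* c p))) ⟩
      ℚof c * P * recip m    ≡⟨ ℚ.*-assoc (ℚof c) P (recip m) ⟩
      ℚof c * (P * recip m)  ≡⟨ cong (ℚof c *_) (recip-inverse m) ⟩
      ℚof c * 1ℚ             ≡⟨ ℚ.*-identityʳ (ℚof c) ⟩
      ℚof c                  ∎
  naturalUnitOrMultiple x d zero    p∤d eq (no p∤n) = ⊥-elim (p∤n (p ℕ.∣0))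
  naturalUnitOrMultiple x d (suc k) p∤d eq (no p∤n) =
    inj₂ (ℚof d * recip k , Integral-* (Integral-ℚof d) (Integral-recip {k} p∤n) , (begin
      x * (ℚof d * recip k)   ≡⟨ ℚ.*-assoc x (ℚof d) (recip k) ⟨
      x * ℚof d * recip k     ≡⟨ cong (_* recip k) eq ⟩
      ℚof (suc k) * recip k   ≡⟨ recip-inverse k ⟩
      1ℚ                      ∎))

  -- The ring is local: if p divides the numerator then x/p is integral over the same denominator,
  -- and otherwise the inverted fraction is integral.
  unitOrMultiple : ∀ {x} → Integral x → x ≈ 0ℚ ⊎ ∃[ b ] (Integral b × x * b ≡ 1ℚ)
  unitOrMultiple {x} (integral d p∤d (+ n) eq)    = naturalUnitOrMultiple x d n p∤d eq (p ℕ.∣? n)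
  unitOrMultiple {x} (integral d p∤d -[1+ k ] eq) =
    [ (λ -x≈0 → inj₁ (≈-trans (≈-reflexive (double-neg x)) (≈-neg -x≈0)))
    , (λ (b , ib , -xb≡1) → inj₂ (- b , Integral-neg ib , trans (neg-neg x b) -xb≡1))
    ]′ (naturalUnitOrMultiple (- x) d (suc k) p∤d (begin
      - x * ℚof d        ≡⟨ ℚ.neg-distribˡ-* x (ℚof d) ⟨
      - (x * ℚof d)      ≡⟨ cong -_ eq ⟩
      - - ℚof (suc k)    ≡⟨ double-neg (ℚof (suc k)) ⟨
      ℚof (suc k)        ∎) (p ℕ.∣? suc k))
    where
    double-neg : ∀ q → q ≡ - - q
    double-neg = solve-∀ ringℚ
    neg-neg : ∀ x b → x * - b ≡ - x * b
    neg-neg = solve-∀ ringℚ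

  -- Used with c = 0 and c = -1, where the two incongruences provide integral inverses of x and x +
  -- 1.
  inverse : ∀ {x c} → Integral x → Integral c → ¬ (x ≡ c [mod p ^ 1 ]) → ∃[ b ] (Integral b × (x - c) * b ≡ 1ℚ)
  inverse {x} {c} ix ic x≢c = [ (λ x-c≈0 → ⊥-elim (x≢c (congruence x-c≈0))) , id ]′ (unitOrMultiple (Integral-− ix ic))
    where
    pow : ∀ P q → 0ℚ + P * q ≡ P * 1ℚ * q
    pow = solve-∀ ringℚ
    congruence : x - c ≈ 0ℚ → x ≡ c [mod p ^ 1 ]
    congruence (congruent q iq x-c≡Pq) = q , Integral⇒InZp iq , trans x-c≡Pq (pow P q)

-- The general congruence in terms of total division

÷'-inverse : ∀ a b c → b * c ≡ 1ℚ → a ÷' b ≡ a * c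
÷'-inverse a b c bc≡1 with b ℚ.≟ 0ℚ
... | yes b≡0 = ⊥-elim (1≢0 (trans (sym bc≡1) (trans (cong (_* c) b≡0) (ℚ.*-zeroˡ c))))
  where
  1≢0 : 1ℚ ≢ 0ℚ
  1≢0 ()
... | no b≢0 = cong (a *_) (begin
  ℚ.1/ b              ≡⟨ ℚ.*-identityʳ (ℚ.1/ b) ⟨
  ℚ.1/ b * 1ℚ         ≡⟨ cong (ℚ.1/ b *_) bc≡1 ⟨
  ℚ.1/ b * (b * c)    ≡⟨ ℚ.*-assoc (ℚ.1/ b) b c ⟨
  ℚ.1/ b * b * c      ≡⟨ cong (_* c) (ℚ.*-inverseˡ b) ⟩
  1ℚ * c              ≡⟨ ℚ.*-identityˡ c ⟩
  c                   ∎)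
  where
  instance
    b-nonZero : ℚ.NonZero b
    b-nonZero = ℚ.≢-nonZero b≢0

sign-double : ∀ l → (- 1ℚ) ^ (l ℕ.* 2) ≡ 1ℚ
sign-double zero    = refl
sign-double (suc l) = cong (λ s → - 1ℚ * (- 1ℚ * s)) (sign-double l)

sign-+double : ∀ i l → (- 1ℚ) ^ (i ℕ.+ l ℕ.* 2) ≡ (- 1ℚ) ^ i
sign-+double zero    l = sign-double l
sign-+double (suc i) l = cong (- 1ℚ *_) (sign-+double i l)

odd⇒sign≡1 : ∀ m → suc m % 2 ≡ 1 → (- 1ℚ) ^ m ≡ 1ℚ
odd⇒sign≡1 m odd = trans (cong ((- 1ℚ) ^_) m≡double) (sign-double (suc m ℕ./ 2))
  where
  m≡double : m ≡ suc m ℕ./ 2 ℕ.* 2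
  m≡double = ℕ.suc-injective (trans (m≡m%n+[m/n]*n (suc m) 2) (cong (ℕ._+ suc m ℕ./ 2 ℕ.* 2) odd))

-- The witness `t` of x ≡ r (mod p) is x' itself, so x = r + p t is the form that `Expansion`
-- expects.
ΣG-general : ∀ p → Prime p → p % 2 ≡ 1 → ∀ x → InZp p x →
  ¬ (x ≡ 0ℚ [mod p ^ 1 ]) → ¬ (x ≡ - 1ℚ [mod p ^ 1 ]) →
  ∀ r → r < p → x ≡ ℚof r [mod p ^ 1 ] →
  let x' = (x - ℚof r) ÷' ℚof p in
  Σ< p (λ n → G n x) ≡ (ℚof p ^ 2) * ((x' * (x' + 1ℚ) + 1ℚ - ((- 1ℚ) ^ r)) ÷' (x * (x + 1ℚ))) [mod p ^ 3 ]
ΣG-general (suc m) p-prime odd x x∈Zp x≢0 x≢-1 r r<p (t , t∈Zp , x-r≡Pt) =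
  subst (λ y → Σ< p (λ n → G n x) ≡ (P ^ 2) * y [mod p ^ 3 ]) (sym value≡)
    (subst (λ y → Σ< p (λ n → G n y) ≡ (P ^ 2) * (value * (b₀ * b₁)) [mod p ^ 3 ]) (sym x≡)
      (ΣG-mod-p³ (Integral-* (proj₁ (proj₂ inv₀)) (proj₁ (proj₂ inv₁)))
        (subst (λ y → y * (y + 1ℚ) * (b₀ * b₁) ≡ 1ℚ) x≡ product-inverse)))
  where
  open ModPrime m p-prime
  it = InZp⇒Integral {t} t∈Zp
  open Expansion (odd⇒sign≡1 m odd) it r<p using (value; ΣG-mod-p³)
  ix = InZp⇒Integral {x} x∈Zp
  inv₀ = inverse ix (Integral-ℚof 0) x≢0
  inv₁ = inverse ix (Integral-ℤof -[1+ 0 ]) x≢-1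
  b₀ = proj₁ inv₀
  b₁ = proj₁ inv₁
  isolate : ∀ x r → x ≡ r + (x - r)
  isolate = solve-∀ ringℚ
  x≡ : x ≡ ℚof r + P * t
  x≡ = begin
    x                        ≡⟨ isolate x (ℚof r) ⟩
    ℚof r + (x - ℚof r)      ≡⟨ cong (λ s → ℚof r + s) x-r≡Pt ⟩
    ℚof r + P * 1ℚ * t       ≡⟨ cong (λ s → ℚof r + s * t) (ℚ.*-identityʳ P) ⟩
    ℚof r + P * t            ∎
  regroup : ∀ x b₀ b₁ → x * (x + 1ℚ) * (b₀ * b₁) ≡ (x - 0ℚ) * b₀ * ((x - - 1ℚ) * b₁)
  regroup = solve-∀ ringℚ
  product-inverse : x * (x + 1ℚ) * (b₀ * b₁) ≡ 1ℚ
  product-inverse = trans (regroup x b₀ b₁) (cong₂ _*_ (proj₂ (proj₂ inv₀)) (proj₂ (proj₂ inv₁)))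
  swap : ∀ P t s → P * 1ℚ * t * s ≡ P * s * t
  swap = solve-∀ ringℚ
  t≡ : (x - ℚof r) ÷' P ≡ t
  t≡ = begin
    (x - ℚof r) ÷' P           ≡⟨ ÷'-inverse (x - ℚof r) P (recip m) (recip-inverse m) ⟩
    (x - ℚof r) * recip m      ≡⟨ cong (_* recip m) x-r≡Pt ⟩
    P * 1ℚ * t * recip m       ≡⟨ swap P t (recip m) ⟩
    P * recip m * t            ≡⟨ cong (_* t) (recip-inverse m) ⟩
    1ℚ * t                     ≡⟨ ℚ.*-identityˡ t ⟩
    t                          ∎
  value≡ : (((x - ℚof r) ÷' P) * (((x - ℚof r) ÷' P) + 1ℚ) + 1ℚ - ((- 1ℚ) ^ r)) ÷' (x * (x + 1ℚ)) ≡ value * (b₀ * b₁)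
  value≡ = begin
    (((x - ℚof r) ÷' P) * (((x - ℚof r) ÷' P) + 1ℚ) + 1ℚ - ((- 1ℚ) ^ r)) ÷' (x * (x + 1ℚ))
      ≡⟨ cong (λ t → (t * (t + 1ℚ) + 1ℚ - ((- 1ℚ) ^ r)) ÷' (x * (x + 1ℚ))) t≡ ⟩
    value ÷' (x * (x + 1ℚ))   ≡⟨ ÷'-inverse value (x * (x + 1ℚ)) (b₀ * b₁) product-inverse ⟩
    value * (b₀ * b₁)         ∎

-- The special values x = -1/3, -1/4, -1/6

-- If c r + 1 = e p, then -1/c = r + p (-e/c), with 0 ≤ r < p because e ≤ c.
ΣG-at-[-1/c] : ∀ p → Prime p → p % 2 ≡ 1 → ∀ c-1 e i n → ¬ (p ∣ suc c-1) → e ℕ.≤ suc c-1 →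
  suc c-1 ℕ.* (i ℕ.+ n ℕ.* 2) ℕ.+ 1 ≡ e ℕ.* p →
  ∀ k d → ¬ (p ∣ suc d) → let x = - recip c-1; t = - (ℚof e * recip c-1); b = ℤof k * recip d in
  x * (x + 1ℚ) * b ≡ 1ℚ → ∀ v → (t * (t + 1ℚ) + 1ℚ - (- 1ℚ) ^ i) * b ≡ v →
  Σ< p (λ j → G j x) ≡ v * (ℚof p ^ 2) [mod p ^ 3 ]
ΣG-at-[-1/c] (suc m) p-prime odd c-1 e i n p∤c e≤c cr+1≡ep k d p∤d ab≡1 v value≡v =
  subst (λ y → Σ< p (λ j → G j x) ≡ y [mod p ^ 3 ]) value≡
    (subst (λ y → Σ< p (λ j → G j y) ≡ (P ^ 2) * (value * b) [mod p ^ 3 ]) (sym x≡)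
      (ΣG-mod-p³ (Integral-* (Integral-ℤof k) (Integral-recip p∤d))
        (subst (λ y → y * (y + 1ℚ) * b ≡ 1ℚ) x≡ ab≡1)))
  where
  open ModPrime m p-prime
  c = suc c-1
  r = i ℕ.+ n ℕ.* 2
  x t b : ℚ
  x = - recip c-1
  t = - (ℚof e * recip c-1)
  b = ℤof k * recip d
  r<p : r < p
  r<p = ℕ.*-cancelˡ-< c r p (ℕ.≤-trans (ℕ.≤-reflexive (trans (ℕ.+-comm 1 (c ℕ.* r)) cr+1≡ep)) (ℕ.*-monoˡ-≤ p e≤c))
  it : Integral t
  it = Integral-neg (Integral-* (Integral-ℚof e) (Integral-recip p∤c))
  open Expansion (odd⇒sign≡1 m odd) it r<p using (value; ΣG-mod-p³)
  expand : ∀ c r P e s → c * (r + P * - (e * s)) ≡ c * r - e * P * (c * s)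
  expand = solve-∀ ringℚ
  collapse : ∀ a → a - (a + 1ℚ) * 1ℚ ≡ - 1ℚ
  collapse = solve-∀ ringℚ
  neg-right : ∀ c s → c * - s ≡ - (c * s)
  neg-right = solve-∀ ringℚ
  EP≡ : ℚof e * P ≡ ℚof c * ℚof r + 1ℚ
  EP≡ = begin
    ℚof e * P                ≡⟨ ℚof-* e p ⟨
    ℚof (e ℕ.* p)            ≡⟨ cong ℚof cr+1≡ep ⟨
    ℚof (c ℕ.* r ℕ.+ 1)      ≡⟨ ℚof-+ (c ℕ.* r) 1 ⟩
    ℚof (c ℕ.* r) + 1ℚ       ≡⟨ cong (_+ 1ℚ) (ℚof-* c r) ⟩
    ℚof c * ℚof r + 1ℚ       ∎
  x≡ : x ≡ ℚof r + P * t
  x≡ = ℚof-suc-cancelˡ c-1 (begin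
    ℚof c * - recip c-1                                      ≡⟨ neg-right (ℚof c) (recip c-1) ⟩
    - (ℚof c * recip c-1)                                    ≡⟨ cong -_ (recip-inverse c-1) ⟩
    - 1ℚ                                                     ≡⟨ collapse (ℚof c * ℚof r) ⟨
    ℚof c * ℚof r - (ℚof c * ℚof r + 1ℚ) * 1ℚ                ≡⟨ cong₂ (λ a s → ℚof c * ℚof r - a * s) EP≡ (recip-inverse c-1) ⟨
    ℚof c * ℚof r - ℚof e * P * (ℚof c * recip c-1)          ≡⟨ expand (ℚof c) (ℚof r) P (ℚof e) (recip c-1) ⟨
    ℚof c * (ℚof r + P * - (ℚof e * recip c-1))              ∎)
  value≡ : (P ^ 2) * (value * b) ≡ v * (P ^ 2)
  value≡ = begin
    (P ^ 2) * (value * b)  ≡⟨ ℚ.*-comm (P ^ 2) (value * b) ⟩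
    -- Only the parity `i` of r = i + 2n enters the value, so one closed computation serves a whole
    -- residue class of p.
    value * b * (P ^ 2)    ≡⟨ cong (λ s → (t * (t + 1ℚ) + 1ℚ - s) * b * (P ^ 2)) (sign-+double i n) ⟩
    (t * (t + 1ℚ) + 1ℚ - (- 1ℚ) ^ i) * b * (P ^ 2) ≡⟨ cong (_* (P ^ 2)) value≡v ⟩
    v * (P ^ 2)            ∎

proper∤prime : ∀ {p d} → Prime p → 1 < d → d < p → ¬ (d ∣ p)
proper∤prime p-prime 1<d d<p d∣p =
  [ (λ d≡1 → ℕ.<⇒≢ 1<d (sym d≡1)) , ℕ.<⇒≢ d<p ]′ (prime⇒irreducible p-prime d∣p)

prime>2⇒odd : ∀ {p} → Prime p → 2 < p → p % 2 ≡ 1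
prime>2⇒odd {p} p-prime 2<p = decide (p % 2) (m%n<n p 2) (λ eq → proper∤prime p-prime ℕ.≤-refl 2<p (ℕ.m%n≡0⇒n∣m p 2 eq))
  where
  decide : ∀ k → k < 2 → k ≢ 0 → k ≡ 1
  decide 0 _ k≢0 = ⊥-elim (k≢0 refl)
  decide 1 _ _   = refl
  decide (suc (suc k)) (ℕ.s≤s (ℕ.s≤s ())) _

reduce-residue : ∀ p m n .{{_ : ℕ.NonZero m}} .{{_ : ℕ.NonZero n}} {j} → m ∣ n → p % m ≡ j → p % n % m ≡ j
reduce-residue p m n m∣n = trans (m∣n⇒o%n%m≡o%m m n p m∣n)

-- As -1/6 ≡ -1 (mod 5), x (x + 1) is not invertible here; the congruence is verified by evaluation.
ΣG-sixth-at-5 : Σ< 5 (λ n → G n (-[1+ 0 ] / 6)) ≡ ℚof 5 ^ 2 [mod 5 ^ 3 ]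
ΣG-sixth-at-5 = quotient , from-no (5 ℕ.∣? ℚ.↧ₙ quotient) , refl
  where
  quotient : ℚ
  quotient = (Σ< 5 (λ n → G n (-[1+ 0 ] / 6)) - (ℚof 5 ^ 2)) * (+ 1 / 125)

-- Residue classes of p for c = 3, 4, 6

module SpecialValues (p : ℕ) (p-prime : Prime p) (3<p : 3 < p) where

  odd : p % 2 ≡ 1
  odd = prime>2⇒odd p-prime (ℕ.<⇒≤ 3<p)

  p∤2 : ¬ (p ∣ 2)
  p∤2 = ℕ.>⇒∤ (ℕ.<⇒≤ 3<p)

  p∤3 : ¬ (p ∣ 3)
  p∤3 = ℕ.>⇒∤ 3<p

  p∤4 : ¬ (p ∣ 4)
  p∤4 p∣4 = [ p∤2 , p∤2 ]′ (euclidsLemma 2 2 p-prime p∣4)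

  p∤6 : ¬ (p ∣ 6)
  p∤6 p∣6 = [ p∤2 , p∤3 ]′ (euclidsLemma 2 3 p-prime p∣6)

  p%3≢0 : p % 3 ≢ 0
  p%3≢0 eq = proper∤prime p-prime (ℕ.s≤s (ℕ.s≤s ℕ.z≤n)) 3<p (ℕ.m%n≡0⇒n∣m p 3 eq)

  -- Turns an identity in a free variable `l` into c r + 1 = e p for the given prime, by taking l to
  -- be the quotient of p by N.
  residue-scaled : ∀ N .{{_ : ℕ.NonZero N}} e {j} (a : ℕ → ℕ) → (∀ l → a l ≡ e ℕ.* (j ℕ.+ l ℕ.* N)) →
    p % N ≡ j → a (p ℕ./ N) ≡ e ℕ.* p
  residue-scaled N e {j} a a≡ p%N≡j = begin
    a (p ℕ./ N)                    ≡⟨ a≡ (p ℕ./ N) ⟩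
    e ℕ.* (j ℕ.+ p ℕ./ N ℕ.* N)    ≡⟨ cong (λ k → e ℕ.* (k ℕ.+ p ℕ./ N ℕ.* N)) p%N≡j ⟨
    e ℕ.* (p % N ℕ.+ p ℕ./ N ℕ.* N) ≡⟨ cong (e ℕ.*_) (m≡m%n+[m/n]*n p N) ⟨
    e ℕ.* p                        ∎

  -- -9/2 is the inverse of x(x+1) = -2/9. The modulus 6 fixes both `e`, an inverse of p modulo 3,
  -- and the parity `i` of r = (e p - 1)/3.
  at-third : ∀ j e i (n : ℕ → ℕ) → e ℕ.≤ 3 → (∀ l → 3 ℕ.* (i ℕ.+ n l ℕ.* 2) ℕ.+ 1 ≡ e ℕ.* (j ℕ.+ l ℕ.* 6)) →
    ∀ v → (let t = - (ℚof e * recip 2) in (t * (t + 1ℚ) + 1ℚ - (- 1ℚ) ^ i) * (-[1+ 8 ] / 2) ≡ v) →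
    p % 6 ≡ j → Σ< p (λ n → G n (-[1+ 0 ] / 3)) ≡ v * (ℚof p ^ 2) [mod p ^ 3 ]
  at-third j e i n e≤3 linear v value p%6≡j =
    ΣG-at-[-1/c] p p-prime odd 2 e i (n (p ℕ./ 6)) p∤3 e≤3
      (residue-scaled 6 e (λ l → 3 ℕ.* (i ℕ.+ n l ℕ.* 2) ℕ.+ 1) linear p%6≡j)
      -[1+ 8 ] 1 p∤2 refl v value

  -- -16/3 is the inverse of x(x+1) = -3/16, and r = (e p - 1)/4 has its parity fixed by p modulo 8.
  at-quarter : ∀ j e i (n : ℕ → ℕ) → e ℕ.≤ 4 → (∀ l → 4 ℕ.* (i ℕ.+ n l ℕ.* 2) ℕ.+ 1 ≡ e ℕ.* (j ℕ.+ l ℕ.* 8)) →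
    ∀ v → (let t = - (ℚof e * recip 3) in (t * (t + 1ℚ) + 1ℚ - (- 1ℚ) ^ i) * (-[1+ 15 ] / 3) ≡ v) →
    p % 8 ≡ j → Σ< p (λ n → G n (-[1+ 0 ] / 4)) ≡ v * (ℚof p ^ 2) [mod p ^ 3 ]
  at-quarter j e i n e≤4 linear v value p%8≡j =
    ΣG-at-[-1/c] p p-prime odd 3 e i (n (p ℕ./ 8)) p∤4 e≤4
      (residue-scaled 8 e (λ l → 4 ℕ.* (i ℕ.+ n l ℕ.* 2) ℕ.+ 1) linear p%8≡j)
      -[1+ 15 ] 2 p∤3 refl v value

  -- -36/5 is the inverse of x(x+1) = -5/36; it is p-integral once p differs from 5.
  at-sixth : p ≢ 5 → ∀ j e i (n : ℕ → ℕ) → e ℕ.≤ 6 → (∀ l → 6 ℕ.* (i ℕ.+ n l ℕ.* 2) ℕ.+ 1 ≡ e ℕ.* (j ℕ.+ l ℕ.* 12)) →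
    ∀ v → (let t = - (ℚof e * recip 5) in (t * (t + 1ℚ) + 1ℚ - (- 1ℚ) ^ i) * (-[1+ 35 ] / 5) ≡ v) →
    p % 12 ≡ j → Σ< p (λ n → G n (-[1+ 0 ] / 6)) ≡ v * (ℚof p ^ 2) [mod p ^ 3 ]
  at-sixth p≢5 j e i n e≤6 linear v value p%12≡j =
    ΣG-at-[-1/c] p p-prime odd 5 e i (n (p ℕ./ 12)) p∤6 e≤6
      (residue-scaled 12 e (λ l → 6 ℕ.* (i ℕ.+ n l ℕ.* 2) ℕ.+ 1) linear p%12≡j)
      -[1+ 35 ] 4 p∤5 refl v value
    where
    p∤5 : ¬ (p ∣ 5)
    p∤5 p∣5 = [ (λ p≡1 → ℕ.<⇒≢ (ℕ.≤-trans (ℕ.s≤s (ℕ.s≤s ℕ.z≤n)) 3<p) (sym p≡1)) , p≢5 ]′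
      (prime⇒irreducible (from-yes (prime? 5)) p∣5)

  unscale : ∀ x → Σ< p (λ n → G n x) ≡ 1ℚ * (ℚof p ^ 2) [mod p ^ 3 ] → Σ< p (λ n → G n x) ≡ ℚof p ^ 2 [mod p ^ 3 ]
  unscale x = subst (λ y → Σ< p (λ n → G n x) ≡ y [mod p ^ 3 ]) (ℚ.*-identityˡ (ℚof p ^ 2))

  -- Oddness together with p modulo 3 determines p modulo 6.
  mod-6 : ∀ {j} → p % 3 ≡ j → p % 6 % 2 ≡ 1 × p % 6 % 3 ≡ j
  mod-6 p%3≡j = reduce-residue p 2 6 (divides-refl 3) odd , reduce-residue p 3 6 (divides-refl 2) p%3≡j

  -- A class modulo 4 splits into three classes modulo 12; excluding multiples of 3 leaves two,
  -- namely 1, 5 or 7, 11.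
  mod-12 : ∀ {j} → p % 4 ≡ j → p % 12 % 3 ≢ 0 × p % 12 % 4 ≡ j
  mod-12 p%4≡j = (λ eq → p%3≢0 (trans (sym (reduce-residue p 3 12 (divides-refl 4) refl)) eq))
    , reduce-residue p 4 12 (divides-refl 3) p%4≡j

  third₁ : p % 3 ≡ 1 → Σ< p (λ n → G n (-[1+ 0 ] / 3)) ≡ ℚof p ^ 2 [mod p ^ 3 ]
  third₁ p%3≡1 = (unscale (-[1+ 0 ] / 3) ∘ at-third 1 1 0 id (ℕ.s≤s ℕ.z≤n) linear₁ 1ℚ refl) (classify (m%n<n p 6) (mod-6 p%3≡1))
    where
    classify : ∀ {k} → k < 6 → k % 2 ≡ 1 × k % 3 ≡ 1 → k ≡ 1
    classify = from-yes (ℕ.allUpTo? (λ k → (k % 2 ℕ.≟ 1 ×-dec k % 3 ℕ.≟ 1) →-dec k ℕ.≟ 1) 6)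
    linear₁ : ∀ l → 3 ℕ.* (0 ℕ.+ l ℕ.* 2) ℕ.+ 1 ≡ 1 ℕ.* (1 ℕ.+ l ℕ.* 6)
    linear₁ = ℕ-solve-∀

  third₂ : p % 3 ≡ 2 → Σ< p (λ n → G n (-[1+ 0 ] / 3)) ≡ (-[1+ 7 ] / 1) * (ℚof p ^ 2) [mod p ^ 3 ]
  -- For p = 6l + 5, e = 2 gives r = 4l + 3 = 1 + 2(1 + 2l), which is odd.
  third₂ p%3≡2 = (at-third 5 2 1 (λ l → 1 ℕ.+ l ℕ.* 2) (ℕ.n≤1+n 2) linear₅ (-[1+ 7 ] / 1) refl) (classify (m%n<n p 6) (mod-6 p%3≡2))
    where
    classify : ∀ {k} → k < 6 → k % 2 ≡ 1 × k % 3 ≡ 2 → k ≡ 5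
    classify = from-yes (ℕ.allUpTo? (λ k → (k % 2 ℕ.≟ 1 ×-dec k % 3 ℕ.≟ 2) →-dec k ℕ.≟ 5) 6)
    linear₅ : ∀ l → 3 ℕ.* (1 ℕ.+ (1 ℕ.+ l ℕ.* 2) ℕ.* 2) ℕ.+ 1 ≡ 2 ℕ.* (5 ℕ.+ l ℕ.* 6)
    linear₅ = ℕ-solve-∀

  quarter₁ : p % 8 ≡ 1 ⊎ p % 8 ≡ 3 → Σ< p (λ n → G n (-[1+ 0 ] / 4)) ≡ ℚof p ^ 2 [mod p ^ 3 ]
  quarter₁ =
    [ unscale (-[1+ 0 ] / 4) ∘ at-quarter 1 1 0 id (ℕ.s≤s ℕ.z≤n) linear₁ 1ℚ refl
    , unscale (-[1+ 0 ] / 4) ∘ at-quarter 3 3 0 (λ l → 1 ℕ.+ l ℕ.* 3) (ℕ.n≤1+n 3) linear₃ 1ℚ refl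
    ]′
    where
    linear₁ : ∀ l → 4 ℕ.* (0 ℕ.+ l ℕ.* 2) ℕ.+ 1 ≡ 1 ℕ.* (1 ℕ.+ l ℕ.* 8)
    linear₁ = ℕ-solve-∀
    linear₃ : ∀ l → 4 ℕ.* (0 ℕ.+ (1 ℕ.+ l ℕ.* 3) ℕ.* 2) ℕ.+ 1 ≡ 3 ℕ.* (3 ℕ.+ l ℕ.* 8)
    linear₃ = ℕ-solve-∀

  quarter₂ : p % 8 ≡ 5 ⊎ p % 8 ≡ 7 → Σ< p (λ n → G n (-[1+ 0 ] / 4)) ≡ (-[1+ 28 ] / 3) * (ℚof p ^ 2) [mod p ^ 3 ]
  quarter₂ =
    [ at-quarter 5 1 1 id (ℕ.s≤s ℕ.z≤n) linear₅ (-[1+ 28 ] / 3) refl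
    , at-quarter 7 3 1 (λ l → 2 ℕ.+ l ℕ.* 3) (ℕ.n≤1+n 3) linear₇ (-[1+ 28 ] / 3) refl
    ]′
    where
    linear₅ : ∀ l → 4 ℕ.* (1 ℕ.+ l ℕ.* 2) ℕ.+ 1 ≡ 1 ℕ.* (5 ℕ.+ l ℕ.* 8)
    linear₅ = ℕ-solve-∀
    linear₇ : ∀ l → 4 ℕ.* (1 ℕ.+ (2 ℕ.+ l ℕ.* 3) ℕ.* 2) ℕ.+ 1 ≡ 3 ℕ.* (7 ℕ.+ l ℕ.* 8)
    linear₇ = ℕ-solve-∀

  sixth₁ : p % 4 ≡ 1 → Σ< p (λ n → G n (-[1+ 0 ] / 6)) ≡ ℚof p ^ 2 [mod p ^ 3 ]
  sixth₁ p%4≡1 = split (p ℕ.≟ 5)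
    where
    classify : ∀ {k} → k < 12 → k % 3 ≢ 0 × k % 4 ≡ 1 → k ≡ 1 ⊎ k ≡ 5
    classify = from-yes (ℕ.allUpTo? (λ k → (¬? (k % 3 ℕ.≟ 0) ×-dec k % 4 ℕ.≟ 1) →-dec (k ℕ.≟ 1 ⊎-dec k ℕ.≟ 5)) 12)
    linear₁ : ∀ l → 6 ℕ.* (0 ℕ.+ l ℕ.* 2) ℕ.+ 1 ≡ 1 ℕ.* (1 ℕ.+ l ℕ.* 12)
    linear₁ = ℕ-solve-∀
    linear₅ : ∀ l → 6 ℕ.* (0 ℕ.+ (2 ℕ.+ l ℕ.* 5) ℕ.* 2) ℕ.+ 1 ≡ 5 ℕ.* (5 ℕ.+ l ℕ.* 12)
    linear₅ = ℕ-solve-∀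
    -- As 5 ≡ 1 (mod 4), the exceptional prime falls in this class.
    split : Dec (p ≡ 5) → Σ< p (λ n → G n (-[1+ 0 ] / 6)) ≡ ℚof p ^ 2 [mod p ^ 3 ]
    split (yes p≡5) = subst (λ p → Σ< p (λ n → G n (-[1+ 0 ] / 6)) ≡ ℚof p ^ 2 [mod p ^ 3 ]) (sym p≡5) ΣG-sixth-at-5
    split (no p≢5) =
      [ unscale (-[1+ 0 ] / 6) ∘ at-sixth p≢5 1 1 0 id (ℕ.s≤s ℕ.z≤n) linear₁ 1ℚ refl
      , unscale (-[1+ 0 ] / 6) ∘ at-sixth p≢5 5 5 0 (λ l → 2 ℕ.+ l ℕ.* 5) (ℕ.n≤1+n 5) linear₅ 1ℚ refl
      ]′ (classify (m%n<n p 12) (mod-12 p%4≡1))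

  sixth₂ : p % 4 ≡ 3 → Σ< p (λ n → G n (-[1+ 0 ] / 6)) ≡ (-[1+ 66 ] / 5) * (ℚof p ^ 2) [mod p ^ 3 ]
  sixth₂ p%4≡3 =
    [ at-sixth p≢5 7 1 1 id (ℕ.s≤s ℕ.z≤n) linear₇ (-[1+ 66 ] / 5) refl
    , at-sixth p≢5 11 5 1 (λ l → 4 ℕ.+ l ℕ.* 5) (ℕ.n≤1+n 5) linear₁₁ (-[1+ 66 ] / 5) refl
    ]′ (classify (m%n<n p 12) (mod-12 p%4≡3))
    where
    1≢3 : 1 ≢ 3
    1≢3 ()
    p≢5 : p ≢ 5
    p≢5 p≡5 = 1≢3 (trans (cong (_% 4) (sym p≡5)) p%4≡3)
    classify : ∀ {k} → k < 12 → k % 3 ≢ 0 × k % 4 ≡ 3 → k ≡ 7 ⊎ k ≡ 11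
    classify = from-yes (ℕ.allUpTo? (λ k → (¬? (k % 3 ℕ.≟ 0) ×-dec k % 4 ℕ.≟ 3) →-dec (k ℕ.≟ 7 ⊎-dec k ℕ.≟ 11)) 12)
    linear₇ : ∀ l → 6 ℕ.* (1 ℕ.+ l ℕ.* 2) ℕ.+ 1 ≡ 1 ℕ.* (7 ℕ.+ l ℕ.* 12)
    linear₇ = ℕ-solve-∀
    linear₁₁ : ∀ l → 6 ℕ.* (1 ℕ.+ (4 ℕ.+ l ℕ.* 5) ℕ.* 2) ℕ.+ 1 ≡ 5 ℕ.* (11 ℕ.+ l ℕ.* 12)
    linear₁₁ = ℕ-solve-∀

theorem3p2 : ((p : ℕ) → Prime p → p % 2 ≡ 1 →
    (x : ℚ) → InZp p x →
    ¬ (x ≡ 0ℚ [mod p ^ 1 ]) → ¬ (x ≡ - 1ℚ [mod p ^ 1 ]) →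
    (r : ℕ) → r < p → x ≡ ℚof r [mod p ^ 1 ] →
    let x' = (x - ℚof r) ÷' ℚof p in
    Σ< p (λ n → G n x)
    ≡ (ℚof p ^ 2) * ((x' * (x' + 1ℚ) + 1ℚ - ((- 1ℚ) ^ r)) ÷' (x * (x + 1ℚ)))
    [mod p ^ 3 ])
    ×
    ((p : ℕ) → Prime p → 3 < p →
    ((p % 3 ≡ 1 → Σ< p (λ n → G n (-[1+ 0 ] / 3)) ≡ ℚof p ^ 2 [mod p ^ 3 ])
    × (p % 3 ≡ 2 → Σ< p (λ n → G n (-[1+ 0 ] / 3)) ≡ (-[1+ 7 ] / 1) * (ℚof p ^ 2) [mod p ^ 3 ]))
    ×
    ((p % 8 ≡ 1 ⊎ p % 8 ≡ 3 → Σ< p (λ n → G n (-[1+ 0 ] / 4)) ≡ ℚof p ^ 2 [mod p ^ 3 ])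
    × (p % 8 ≡ 5 ⊎ p % 8 ≡ 7 → Σ< p (λ n → G n (-[1+ 0 ] / 4)) ≡ (-[1+ 28 ] / 3) * (ℚof p ^ 2) [mod p ^ 3 ]))
    ×
    ((p % 4 ≡ 1 → Σ< p (λ n → G n (-[1+ 0 ] / 6)) ≡ ℚof p ^ 2 [mod p ^ 3 ])
    × (p % 4 ≡ 3 → Σ< p (λ n → G n (-[1+ 0 ] / 6)) ≡ (-[1+ 66 ] / 5) * (ℚof p ^ 2) [mod p ^ 3 ])))
theorem3p2 = ΣG-general , λ p p-prime 3<p →
  let open SpecialValues p p-prime 3<p in (third₁ , third₂) , (quarter₁ , quarter₂) , (sixth₁ , sixth₂)
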